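{- For $2w\le n$, let $\mathbb{F}_2^{n,w}$ be the set of binary vectors of length $n$ with exactly $w$ ones, with distance $\tau(x,y)=|\{i:x_i\ne y_i\}|/2$, and let $A(\mathbb{F}_2^{n,w},s)$ be the maximum cardinality of a subset $X\subset\mathbb{F}_2^{n,w}$ whose set of distances between distinct elements has exactly $s$ elements. (1) For $11\le n\le 45$ and $4\le w\le n/2$, $A(\mathbb{F}_2^{n,w},3)\le \binom{n}{3}-\binom{n}{2}+n$. (2) If $n,w$ satisfy one of: $11\le n\le12$ and $w=4$; $13\le n\le 15$ and $4\le w\le 5$; $16\le n\le 19$ and $4\le w\le 6$; $20\le n\le 24$ and $4\le w\le 7$; $25\le n\le 50$ and $4\le w\le 8$; then $A(\mathbb{F}_2^{n,w},3)=\binom{n-w+3}{3}$.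
   Context: None beyond the definitions in the claim. -}

module Defs where

open import Data.Nat using (ℕ; zero; suc; _+_; _*_; _∸_; _≤_; ⌊_/2⌋)
open import Data.Bool using (Bool; true; false; _xor_; if_then_else_)
open import Data.Vec using (Vec; []; _∷_)
open import Data.List using (List; length)
open import Data.List.Membership.Propositional using (_∈_)
open import Data.List.Relation.Unary.All using (All)
open import Data.List.Relation.Unary.Unique.Propositional using (Unique)
open import Data.Product using (Σ; ∃; _×_; _,_)
open import Relation.Binary.PropositionalEquality using (_≡_; _≢_)

weight : ∀ {n} → Vec Bool n → ℕ
weight [] = 0
weight (b ∷ bs) = (if b then 1 else 0) + weight bs

hamming : ∀ {n} → Vec Bool n → Vec Bool n → ℕ
hamming [] [] = 0
hamming (x ∷ xs) (y ∷ ys) = (if x xor y then 1 else 0) + hamming xs ys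

-- τ(x,y) = |{i : x_i ≠ y_i}| / 2  (always even on F_2^{n,w})
τ : ∀ {n} → Vec Bool n → Vec Bool n → ℕ
τ x y = ⌊ hamming x y /2⌋

IsDistanceSetOf : ∀ {n} → List (Vec Bool n) → List ℕ → Set
IsDistanceSetOf {n} X D =
  Unique D ×
  (∀ (x y : Vec Bool n) → x ∈ X → y ∈ X → x ≢ y → τ x y ∈ D) ×
  (∀ d → d ∈ D → Σ (Vec Bool n) λ x → Σ (Vec Bool n) λ y →
      x ∈ X × y ∈ X × x ≢ y × τ x y ≡ d)

IsSDistanceSet : (n w s : ℕ) → List (Vec Bool n) → Set
IsSDistanceSet n w s X =
  All (λ x → weight x ≡ w) X × Unique X ×
  Σ (List ℕ) λ D → length D ≡ s × IsDistanceSetOf X D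

A≤ : (n w s b : ℕ) → Set
A≤ n w s b = ∀ (X : List (Vec Bool n)) → IsSDistanceSet n w s X → length X ≤ b

A≡ : (n w s b : ℕ) → Set
A≡ n w s b = A≤ n w s b ×
  Σ (List (Vec Bool n)) λ X → IsSDistanceSet n w s X × length X ≡ b

{-# OPTIONS --safe #-}
-- For c : X → ℤ and k pairwise disjoint ordered pairs (i , j) of coordinates, the square of
-- ∑ₓ c(x) ∏ (xᵢ − xⱼ) is nonnegative; summed over all choices of the pairs it is a quadratic form in c whose
-- coefficient at (x , y) is a spherical function Sₖ(τ(x,y)) of the Johnson scheme.  Let F = ∑ fₖ Sₖ vanish
-- on the distance set D of X, so that the form of F is F(0) ∑ c(x)².
--  * Delsarte: if f₀ > 0 and all other fₖ ≥ 0, then c = 1 gives |X| ≤ F(0) / f₀.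
--  * Musin–Nozaki: if F = f₀S₀ + f₁S₁ + f₂S₂ + f₃S₃ with f₂ ≤ 0 < F(0), then |X| ≤ C(n,3) − C(n,2) + n, as
--    otherwise some c ≠ 0 is killed by the forms S₀, S₁ and S₃.  Such a c solves a homogeneous system whose
--    unknowns are c and a function g on pairs: the singleton moments of c vanish, and its triple moments
--    are those lifted from g.
--  * Larman–Rogers–Seidel: if (e − d)(f − d) ∤ ef for D = {d , e , f}, then |X| ≤ n + C(n,2), as otherwise
--    some c ≠ 0 is orthogonal to all products xᵢxⱼ; then ∑ₓ c(x) (e − τ(x,y))(f − τ(x,y)) = 0 for all y ∈ X
--    forces a nontrivial divisor of all values of c, which can be divided out forever.
-- Every distance set in the range of the theorem falls under one of the three, with F computed from D and
-- three degrees by Cramer's rule.  The bound C(n−w+3,3) is attained by the w-sets through w − 3 fixed points.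
module Submission where

open import Defs
open import Data.Bool using (Bool; true; false; not; _∧_; _∨_; _xor_; if_then_else_; T; T?)
open import Data.Bool.ListAction using (any; all)
open import Data.Bool.Properties as Boolₚ using (T-∧; T-∨)
open import Data.Empty using (⊥)
open import Data.Fin as Fin using (Fin; zero; suc)
open import Data.Fin.Properties as Finₚ using ()
open import Data.List using (List; []; _∷_; _++_; map; length; allFin; applyUpTo; filter; cartesianProduct)
open import Data.List.Membership.Propositional using (_∈_; find)
open import Data.List.Membership.Propositional.Properties using (∈-∃++; ∈-map⁺; ∈-map⁻; ∈-++⁺ˡ; ∈-++⁺ʳ; ∈-++⁻; ∈-allFin; ∈-applyUpTo⁺; ∈-filter⁺; ∈-cartesianProduct⁺)
open import Data.List.Properties using (length-map; length-++; length-tabulate; map-tabulate)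
open import Data.List.Relation.Binary.Permutation.Propositional using (_↭_; ↭-refl; ↭-sym; ↭-trans; prep; swap; ↭⇒↭ₛ)
open import Data.List.Relation.Binary.Permutation.Propositional.Properties using (shift; ↭-length; All-resp-↭; ∈-resp-↭)
import Data.List.Relation.Binary.Permutation.Setoid.Properties as Permutationₛ
open import Data.List.Relation.Unary.All as All using (All; []; _∷_)
open import Data.List.Relation.Unary.All.Properties using (¬Any⇒All¬; map⁻; ++⁻; all⁺)
open import Data.List.Relation.Unary.AllPairs using ([]; _∷_)
open import Data.List.Relation.Unary.Any using (here; there; any?; satisfied)
open import Data.List.Relation.Unary.Any.Properties using (any⁻)
open import Data.List.Relation.Unary.Unique.Propositional using (Unique)
import Data.List.Relation.Unary.Unique.Propositional.Properties as Uniqueₚ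
open import Data.Nat as ℕ using (ℕ; zero; suc; s≤s; z≤n)
open import Data.Nat.Combinatorics using (_C_; nC1≡n; nCn≡1; nCk≡nC[n∸k]; k>n⇒nCk≡0; nCk+nC[k+1]≡[n+1]C[k+1])
open import Data.Nat.Coprimality as Coprimality using (coprime-/gcd; coprime-divisor)
open import Data.Nat.DivMod using (_/_; m/n*n≡m)
open import Data.Nat.Divisibility using (_∣_; divides; _∣?_)
open import Data.Nat.GCD using (gcd; gcd[m,n]∣m; gcd[m,n]∣n; gcd[m,n]≢0)
open import Data.Nat.Properties as ℕₚ using ()
open import Data.Nat.Tactic.RingSolver using () renaming (solve-∀ to ℕ-solve-∀)
open import Data.Product using (Σ; ∃; ∃₂; _×_; _,_; proj₁; proj₂)
import Data.Product.Properties as Productₚ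
import Data.Sign as Sign
import Data.Sign.Properties as Signₚ
open import Data.Sum using (_⊎_; inj₁; inj₂; [_,_]′)
import Data.Sum.Properties as Sumₚ
open import Data.Unit using (tt)
open import Data.Vec as Vec using (Vec; []; _∷_; lookup; replicate)
import Data.Vec.Properties as Vecₚ
open import Function using (id; _∘_)
open import Function.Bundles using (module Equivalence)
open import Relation.Binary.Definitions using (DecidableEquality; tri<; tri≈; tri>)
open import Relation.Binary.PropositionalEquality using (_≡_; _≢_; refl; sym; trans; cong; cong₂; subst; subst₂; setoid; module ≡-Reasoning)
open import Relation.Nullary using (¬_; yes; no; does; ¬?; contradiction)
open import Relation.Nullary.Decidable using (decidable-stable; dec-true; dec-false; isYes)

private variable
  A B : Set
  n : ℕ

module _ where
  open import Data.Integer using (ℤ; +_; -[1+_]; _+_; _-_; _*_; -_; 0ℤ; 1ℤ; _≟_; _≤_; _<_; +≤+; +<+; -≤+; ∣_∣; _◃_; sign; Positive; positive; nonNegative)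
  open import Data.Integer.Properties
  open import Data.Integer.Tactic.RingSolver using (solve-∀)
  open Equivalence using (to)

  -- Sums over lists and homogeneous linear systems

  module _ where
    open ≡-Reasoning

    ∑ : List A → (A → ℤ) → ℤ
    ∑ []       f = 0ℤ
    ∑ (x ∷ xs) f = f x + ∑ xs f

    ∑-cong-∈ : ∀ (xs : List A) {f g} → (∀ {x} → x ∈ xs → f x ≡ g x) → ∑ xs f ≡ ∑ xs g
    ∑-cong-∈ []       eq = refl
    ∑-cong-∈ (x ∷ xs) eq = cong₂ _+_ (eq (here refl)) (∑-cong-∈ xs (λ x∈ → eq (there x∈)))

    ∑-cong : ∀ (xs : List A) {f g} → (∀ x → f x ≡ g x) → ∑ xs f ≡ ∑ xs g
    ∑-cong xs eq = ∑-cong-∈ xs (λ {x} _ → eq x)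

    ∑-0 : ∀ (xs : List A) → ∑ xs (λ _ → 0ℤ) ≡ 0ℤ
    ∑-0 []       = refl
    ∑-0 (x ∷ xs) = trans (+-identityˡ _) (∑-0 xs)

    ∑-vanish : ∀ (xs : List A) {f} → (∀ {x} → x ∈ xs → f x ≡ 0ℤ) → ∑ xs f ≡ 0ℤ
    ∑-vanish xs eq = trans (∑-cong-∈ xs eq) (∑-0 xs)

    ∑-+ : ∀ (xs : List A) (f g : A → ℤ) → ∑ xs (λ x → f x + g x) ≡ ∑ xs f + ∑ xs g
    ∑-+ []       f g = refl
    ∑-+ (x ∷ xs) f g = trans (cong (_+_ (f x + g x)) (∑-+ xs f g)) (interchange (f x) (g x) _ _)
      where
      interchange : ∀ a b c d → a + b + (c + d) ≡ a + c + (b + d)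
      interchange = solve-∀

    ∑-*ˡ : ∀ (xs : List A) a (f : A → ℤ) → ∑ xs (λ x → a * f x) ≡ a * ∑ xs f
    ∑-*ˡ []       a f = sym (*-zeroʳ a)
    ∑-*ˡ (x ∷ xs) a f = trans (cong (_+_ (a * f x)) (∑-*ˡ xs a f)) (sym (*-distribˡ-+ a (f x) _))

    ∑-*ʳ : ∀ (xs : List A) a (f : A → ℤ) → ∑ xs (λ x → f x * a) ≡ ∑ xs f * a
    ∑-*ʳ xs a f = trans (∑-cong xs (λ x → *-comm (f x) a)) (trans (∑-*ˡ xs a f) (*-comm a _))

    ∑-swap : ∀ (xs : List A) (ys : List B) (f : A → B → ℤ) →
             ∑ xs (λ x → ∑ ys (f x)) ≡ ∑ ys (λ y → ∑ xs (λ x → f x y))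
    ∑-swap []       ys f = sym (∑-0 ys)
    ∑-swap (x ∷ xs) ys f = trans (cong (_+_ (∑ ys (f x))) (∑-swap xs ys f)) (sym (∑-+ ys (f x) _))

    ∑-map : ∀ (h : A → B) (xs : List A) (f : B → ℤ) → ∑ (map h xs) f ≡ ∑ xs (λ x → f (h x))
    ∑-map h []       f = refl
    ∑-map h (x ∷ xs) f = cong (_+_ (f (h x))) (∑-map h xs f)

    ∑-++ : ∀ (xs ys : List A) (f : A → ℤ) → ∑ (xs ++ ys) f ≡ ∑ xs f + ∑ ys f
    ∑-++ []       ys f = sym (+-identityˡ _)
    ∑-++ (x ∷ xs) ys f = trans (cong (_+_ (f x)) (∑-++ xs ys f)) (sym (+-assoc (f x) _ _))

    ∑-≥0 : ∀ (xs : List A) {f} → (∀ x → 0ℤ ≤ f x) → 0ℤ ≤ ∑ xs f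
    ∑-≥0 []       f≥0 = ≤-refl
    ∑-≥0 (x ∷ xs) f≥0 = +-mono-≤ (f≥0 x) (∑-≥0 xs f≥0)

    ∑-single : ∀ {xs : List A} {x} {f} → Unique xs → x ∈ xs →
               (∀ {y} → y ∈ xs → x ≢ y → f y ≡ 0ℤ) → ∑ xs f ≡ f x
    ∑-single {xs = x ∷ xs} {f = f} (x∉ ∷ u) (here refl) f0 = begin
      f x + ∑ xs f  ≡⟨ cong (_+_ (f x)) (∑-vanish xs (λ y∈ → f0 (there y∈) (All.lookup x∉ y∈))) ⟩
      f x + 0ℤ      ≡⟨ +-identityʳ _ ⟩
      f x           ∎
    ∑-single {xs = z ∷ xs} {x} {f} (z∉ ∷ u) (there x∈) f0 = begin
      f z + ∑ xs f  ≡⟨ cong (_+ ∑ xs f) (f0 (here refl) (λ x≡z → All.lookup z∉ x∈ (sym x≡z))) ⟩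
      0ℤ + ∑ xs f   ≡⟨ +-identityˡ _ ⟩
      ∑ xs f        ≡⟨ ∑-single u x∈ (λ y∈ → f0 (there y∈)) ⟩
      f x           ∎

    ∈⇒↭ : ∀ {x : A} {xs} → x ∈ xs → ∃ λ ys → xs ↭ x ∷ ys
    ∈⇒↭ x∈ with ∈-∃++ x∈
    ... | ys , zs , refl = ys ++ zs , shift _ ys zs

    module _ {V : Set} (_≟ᵥ_ : DecidableEquality V) where

      private
        extend : V → ℤ → (V → ℤ) → V → ℤ
        extend v a c u = if does (u ≟ᵥ v) then a else c u

        extend-here : ∀ v a c → extend v a c v ≡ a
        extend-here v a c with v ≟ᵥ v
        ... | yes _   = refl
        ... | no v≢v = contradiction refl v≢v

        extend-there : ∀ {v u} a c → v ≢ u → extend v a c u ≡ c u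
        extend-there {v} {u} a c v≢u with u ≟ᵥ v
        ... | yes u≡v = contradiction (sym u≡v) v≢u
        ... | no _    = refl

        ∑-extend : ∀ {v vs} a c (e : V → ℤ) → All (v ≢_) vs →
                   ∑ (v ∷ vs) (λ u → extend v a c u * e u) ≡ a * e v + ∑ vs (λ u → c u * e u)
        ∑-extend {v} {vs} a c e v∉ = cong₂ _+_ (cong (_* e v) (extend-here v a c))
          (∑-cong-∈ vs (λ {u} u∈ → cong (_* e u) (extend-there a c (All.lookup v∉ u∈))))

        ∑-scale : ∀ (vs : List V) a (c e : V → ℤ) → ∑ vs (λ u → a * c u * e u) ≡ a * ∑ vs (λ u → c u * e u)
        ∑-scale vs a c e = trans (∑-cong vs (λ u → *-assoc a (c u) (e u))) (∑-*ˡ vs a _)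

        -- Cross-multiplied row elimination: the coefficient at `v` cancels and all entries stay
        -- integral.
        eliminate : (V → ℤ) → V → (V → ℤ) → V → ℤ
        eliminate e v e′ u = e v * e′ u - e′ v * e u

        ∑-eliminate : ∀ vs (c : V → ℤ) e v e′ → ∑ vs (λ u → c u * eliminate e v e′ u) ≡
                      e v * ∑ vs (λ u → c u * e′ u) - e′ v * ∑ vs (λ u → c u * e u)
        ∑-eliminate vs c e v e′ = begin
          ∑ vs (λ u → c u * eliminate e v e′ u)
            ≡⟨ ∑-cong vs (λ u → ring₁ (c u) (e v) (e′ u) (e′ v) (e u)) ⟩
          ∑ vs (λ u → e v * (c u * e′ u) + - e′ v * (c u * e u))
            ≡⟨ ∑-+ vs _ _ ⟩
          ∑ vs (λ u → e v * (c u * e′ u)) + ∑ vs (λ u → - e′ v * (c u * e u))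
            ≡⟨ cong₂ _+_ (∑-*ˡ vs (e v) _) (∑-*ˡ vs (- e′ v) _) ⟩
          e v * ∑ vs (λ u → c u * e′ u) + - e′ v * ∑ vs (λ u → c u * e u)
            ≡⟨ ring₂ (e v) (∑ vs (λ u → c u * e′ u)) (e′ v) (∑ vs (λ u → c u * e u)) ⟩
          e v * ∑ vs (λ u → c u * e′ u) - e′ v * ∑ vs (λ u → c u * e u) ∎
          where
          ring₁ : ∀ c a b d f → c * (a * b - d * f) ≡ a * (c * b) + - d * (c * f)
          ring₁ = solve-∀
          ring₂ : ∀ a s b t → a * s + - b * t ≡ a * s - b * t
          ring₂ = solve-∀

      -- Gaussian elimination without fractions, by induction on the unknowns. If no equation
      -- involves `v`, the unit vector at `v` is a solution. Otherwise an equation with `e v`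
      -- nonzero serves as pivot, and both an equation and an unknown disappear.
      null-vector : ∀ {vs} → Unique vs → (es : List (V → ℤ)) → length es ℕ.< length vs →
                    Σ (V → ℤ) λ c → (∃ λ v → v ∈ vs × c v ≢ 0ℤ) × All (λ e → ∑ vs (λ v → c v * e v) ≡ 0ℤ) es
      null-vector {v ∷ vs} (v∉ ∷ u) es lt with any? (λ e → ¬? (e v ≟ 0ℤ)) es
      ... | no none = extend v 1ℤ (λ _ → 0ℤ) , (v , here refl , subst (_≢ 0ℤ) (sym (extend-here v _ _)) (λ ())) ,
        All.map (λ {e} e≡0 → begin
          ∑ (v ∷ vs) (λ u → extend v 1ℤ (λ _ → 0ℤ) u * e u)  ≡⟨ ∑-extend 1ℤ _ e v∉ ⟩
          1ℤ * e v + ∑ vs (λ u → 0ℤ * e u)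
            ≡⟨ cong₂ _+_ (trans (*-identityˡ _) (decidable-stable (e v ≟ 0ℤ) e≡0)) (∑-vanish vs (λ {u} _ → *-zeroˡ (e u))) ⟩
          0ℤ ∎) (¬Any⇒All¬ es none)
      ... | yes some with find some
      ...   | e , e∈ , ev≢0 with ∈⇒↭ e∈
      ...     | es′ , perm with null-vector u (map (eliminate e v) es′)
                               (subst (ℕ._< length vs) (sym (length-map _ es′))
                                 (ℕ.s≤s⁻¹ (subst (λ l → suc l ℕ.≤ suc (length vs)) (↭-length perm) lt)))
      ...       | c , (u₀ , u₀∈ , cu₀≢0) , sols =
        c′ , (u₀ , there u₀∈ , c′u₀≢0) ,
        All-resp-↭ (↭-sym perm) (pivot ∷ All.map (λ {e′} → rest e′) (map⁻ sols))
        where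
        t = ∑ vs (λ u → c u * e u)
        -- The solution of the reduced system is scaled by `e v`, so that the pivot equation has the
        -- integral solution `- t` at `v`.
        c′ = extend v (- t) (λ u → e v * c u)
        c′u₀≢0 : c′ u₀ ≢ 0ℤ
        c′u₀≢0 eq with i*j≡0⇒i≡0∨j≡0 (e v) (trans (sym (extend-there (- t) (λ u → e v * c u) (All.lookup v∉ u₀∈))) eq)
        ... | inj₁ p = ev≢0 p
        ... | inj₂ p = cu₀≢0 p
        ∑-c′ : ∀ e′ → ∑ (v ∷ vs) (λ u → c′ u * e′ u) ≡ - t * e′ v + e v * ∑ vs (λ u → c u * e′ u)
        ∑-c′ e′ = trans (∑-extend (- t) _ e′ v∉) (cong (_+_ (- t * e′ v)) (∑-scale vs (e v) c e′))
        pivot : ∑ (v ∷ vs) (λ u → c′ u * e u) ≡ 0ℤ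
        pivot = trans (∑-c′ e) (cancel t (e v))
          where
          cancel : ∀ t a → - t * a + a * t ≡ 0ℤ
          cancel = solve-∀
        rest : ∀ e′ → ∑ vs (λ u → c u * eliminate e v e′ u) ≡ 0ℤ → ∑ (v ∷ vs) (λ u → c′ u * e′ u) ≡ 0ℤ
        rest e′ eq = begin
          ∑ (v ∷ vs) (λ u → c′ u * e′ u)                ≡⟨ ∑-c′ e′ ⟩
          - t * e′ v + e v * ∑ vs (λ u → c u * e′ u)    ≡⟨ regroup t (e′ v) _ ⟩
          e v * ∑ vs (λ u → c u * e′ u) - e′ v * t      ≡⟨ sym (∑-eliminate vs c e v e′) ⟩
          ∑ vs (λ u → c u * eliminate e v e′ u)         ≡⟨ eq ⟩
          0ℤ                                            ∎
          where
          regroup : ∀ t a b → - t * a + b ≡ b - a * t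
          regroup = solve-∀

  -- Positive semidefinite kernels

  module _ where
    open ≡-Reasoning

    -- Keeping the remaining entries lets the next draw be made from them, so nested draws use
    -- disjoint positions.
    picks : List A → List (A × List A)
    picks []       = []
    picks (x ∷ xs) = (x , xs) ∷ map (λ (y , ys) → y , x ∷ ys) (picks xs)

    picks-↭ : ∀ (xs : List A) {y ys} → (y , ys) ∈ picks xs → xs ↭ y ∷ ys
    picks-↭ (x ∷ xs) (here refl) = ↭-refl
    picks-↭ (x ∷ xs) (there p) with ∈-map⁻ _ p
    ... | (y , ys) , q , refl = ↭-trans (prep x (picks-↭ xs q)) (swap x y ↭-refl)

    ∑-picks : ∀ (xs : List A) f → ∑ (picks xs) (λ p → f (proj₁ p)) ≡ ∑ xs f
    ∑-picks []       f = refl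
    ∑-picks (x ∷ xs) f = cong (_+_ (f x)) (trans (∑-map _ (picks xs) _) (∑-picks xs f))

    ∑-↭ : ∀ {xs ys : List A} (f : A → ℤ) → xs ↭ ys → ∑ xs f ≡ ∑ ys f
    ∑-↭ f _↭_.refl          = refl
    ∑-↭ f (prep x p)        = cong (_+_ (f x)) (∑-↭ f p)
    ∑-↭ f (swap x y p)      = trans (cong (λ s → f x + (f y + s)) (∑-↭ f p)) (exchange (f x) (f y) _)
      where
      exchange : ∀ a b c → a + (b + c) ≡ b + (a + c)
      exchange = solve-∀
    ∑-↭ f (_↭_.trans p q)   = trans (∑-↭ f p) (∑-↭ f q)

    -- Drawing two entries omits only the diagonal terms `f x * g x` of the product of the sums, and
    -- these vanish.
    ∑-picks² : ∀ (xs : List A) (f g : A → ℤ) → (∀ x → f x * g x ≡ 0ℤ) →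
               ∑ (picks xs) (λ (x , ys) → ∑ (picks ys) (λ (y , _) → f x * g y)) ≡ ∑ xs f * ∑ xs g
    ∑-picks² xs f g fg≡0 = begin
      ∑ (picks xs) (λ (x , ys) → ∑ (picks ys) (λ (y , _) → f x * g y))
        ≡⟨ ∑-cong-∈ (picks xs) (λ {p} p∈ → inner (proj₁ p) (proj₂ p) (picks-↭ xs p∈)) ⟩
      ∑ (picks xs) (λ (x , _) → f x * ∑ xs g)  ≡⟨ ∑-picks xs (λ x → f x * ∑ xs g) ⟩
      ∑ xs (λ x → f x * ∑ xs g)                ≡⟨ ∑-*ʳ xs (∑ xs g) f ⟩
      ∑ xs f * ∑ xs g                          ∎
      where
      inner : ∀ x ys → xs ↭ x ∷ ys → ∑ (picks ys) (λ (y , _) → f x * g y) ≡ f x * ∑ xs g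
      inner x ys xs↭ = begin
        ∑ (picks ys) (λ (y , _) → f x * g y)  ≡⟨ ∑-picks ys (λ y → f x * g y) ⟩
        ∑ ys (λ y → f x * g y)                ≡⟨ ∑-*ˡ ys (f x) g ⟩
        f x * ∑ ys g                          ≡⟨ sym (+-identityˡ _) ⟩
        0ℤ + f x * ∑ ys g                     ≡⟨ cong (λ z → z + f x * ∑ ys g) (sym (fg≡0 x)) ⟩
        f x * g x + f x * ∑ ys g              ≡⟨ sym (*-distribˡ-+ (f x) (g x) (∑ ys g)) ⟩
        f x * (g x + ∑ ys g)                  ≡⟨ cong (f x *_) (sym (∑-↭ g xs↭)) ⟩
        f x * ∑ xs g                          ∎

    ⟦_⟧ : Bool → ℤ
    ⟦ true ⟧  = 1ℤ
    ⟦ false ⟧ = 0ℤ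

    bit : Vec Bool n → Fin n → ℤ
    bit x i = ⟦ lookup x i ⟧

    -- The energy of a weighting c is the sum, over all ways to draw k disjoint ordered pairs (i , j)
    -- of coordinates from L, of the square of ∑ₓ c(x) ∏ (xᵢ − xⱼ).
    energy : List (Vec Bool n) → ℕ → List (Fin n) → (Vec Bool n → ℤ) → ℤ
    energy X zero    L c = ∑ X c * ∑ X c
    energy X (suc k) L c = ∑ (picks L) λ (i , L′) → ∑ (picks L′) λ (j , L″) →
      energy X k L″ (λ x → c x * (bit x i - bit x j))

    square-≥0 : ∀ i → 0ℤ ≤ i * i
    square-≥0 (+ zero)  = ≤-refl
    square-≥0 (+ suc m) = +≤+ z≤n
    square-≥0 -[1+ m ]  = +≤+ z≤n

    energy-≥0 : ∀ (X : List (Vec Bool n)) k L c → 0ℤ ≤ energy X k L c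
    energy-≥0 X zero    L c = square-≥0 (∑ X c)
    energy-≥0 X (suc k) L c = ∑-≥0 (picks L) λ (i , L′) → ∑-≥0 (picks L′) λ (j , L″) → energy-≥0 X k L″ _

    -- The coefficient of `c x * c y` once the squares in `energy` are opened.
    kernel : ℕ → List (Fin n) → Vec Bool n → Vec Bool n → ℤ
    kernel zero    L x y = 1ℤ
    kernel (suc k) L x y = ∑ (picks L) λ (i , L′) → ∑ (picks L′) λ (j , L″) →
      (bit x i - bit x j) * (bit y i - bit y j) * kernel k L″ x y

    ∑∑-cong : ∀ (xs : List A) {f g : A → A → ℤ} → (∀ x y → f x y ≡ g x y) →
              ∑ xs (λ x → ∑ xs (f x)) ≡ ∑ xs (λ x → ∑ xs (g x))
    ∑∑-cong xs eq = ∑-cong xs (λ x → ∑-cong xs (eq x))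

    -- Induction on `k` for all weightings at once: the factor of the drawn pair belongs to the
    -- weighting on the side of `energy` and to the kernel on the other side.
    energy-kernel : ∀ (X : List (Vec Bool n)) k L c →
                    energy X k L c ≡ ∑ X (λ x → ∑ X (λ y → c x * c y * kernel k L x y))
    energy-kernel X zero L c = begin
      ∑ X c * ∑ X c                                ≡⟨ sym (∑-*ʳ X (∑ X c) c) ⟩
      ∑ X (λ x → c x * ∑ X c)                      ≡⟨ ∑-cong X (λ x → sym (∑-*ˡ X (c x) c)) ⟩
      ∑ X (λ x → ∑ X (λ y → c x * c y))            ≡⟨ ∑∑-cong X (λ x y → sym (*-identityʳ (c x * c y))) ⟩
      ∑ X (λ x → ∑ X (λ y → c x * c y * 1ℤ))       ∎
    energy-kernel X (suc k) L c = begin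
      ∑ (picks L) (λ (i , L′) → ∑ (picks L′) λ (j , L″) → energy X k L″ (λ x → c x * (bit x i - bit x j)))
        ≡⟨ ∑-cong (picks L) (λ (i , L′) → ∑-cong (picks L′) λ (j , L″) →
             trans (energy-kernel X k L″ _) (∑∑-cong X λ x y →
               regroup (c x) (bit x i - bit x j) (c y) (bit y i - bit y j) (kernel k L″ x y))) ⟩
      ∑ (picks L) (λ (i , L′) → ∑ (picks L′) λ (j , L″) → ∑ X λ x → ∑ X λ y → term x y i j L″)
        ≡⟨ ∑-cong (picks L) (λ (i , L′) → trans (∑-swap (picks L′) X _) (∑-cong X λ x → ∑-swap (picks L′) X _)) ⟩
      ∑ (picks L) (λ (i , L′) → ∑ X λ x → ∑ X λ y → ∑ (picks L′) λ (j , L″) → term x y i j L″)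
        ≡⟨ trans (∑-swap (picks L) X _) (∑-cong X λ x → ∑-swap (picks L) X _) ⟩
      ∑ X (λ x → ∑ X λ y → ∑ (picks L) λ (i , L′) → ∑ (picks L′) λ (j , L″) → term x y i j L″)
        ≡⟨ ∑∑-cong X (λ x y → trans (∑-cong (picks L) (λ (i , L′) → ∑-*ˡ (picks L′) (c x * c y) _))
                                    (∑-*ˡ (picks L) (c x * c y) _)) ⟩
      ∑ X (λ x → ∑ X (λ y → c x * c y * kernel (suc k) L x y)) ∎
      where
      term : ∀ x y i j L″ → ℤ
      term x y i j L″ = c x * c y * ((bit x i - bit x j) * (bit y i - bit y j) * kernel k L″ x y)
      regroup : ∀ a b c d e → a * b * (c * d) * e ≡ a * c * (b * d * e)
      regroup = solve-∀

    -- p, a, b, q count the coordinates in both vectors, only the first, only the second, neither.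
    spherical : ℕ → ℤ → ℤ → ℤ → ℤ → ℤ
    spherical zero    p a b q = 1ℤ
    spherical (suc k) p a b q = + 2 * (p * q * spherical k (p - 1ℤ) a b (q - 1ℤ) - a * b * spherical k p (a - 1ℤ) (b - 1ℤ) q)

    module _ (x y : Vec Bool n) where

      both onlyˡ onlyʳ neither : Fin n → ℤ
      both    i = ⟦ lookup x i ∧ lookup y i ⟧
      onlyˡ   i = ⟦ lookup x i ∧ not (lookup y i) ⟧
      onlyʳ   i = ⟦ not (lookup x i) ∧ lookup y i ⟧
      neither i = ⟦ not (lookup x i) ∧ not (lookup y i) ⟧

      private
        disjoint₁ : ∀ i → both i * neither i ≡ 0ℤ
        disjoint₁ i with lookup x i | lookup y i
        ... | true  | true  = refl
        ... | true  | false = refl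
        ... | false | _     = refl

        disjoint₂ : ∀ i → onlyˡ i * onlyʳ i ≡ 0ℤ
        disjoint₂ i with lookup x i | lookup y i
        ... | true  | true  = refl
        ... | true  | false = refl
        ... | false | _     = refl

        cong₄ : ∀ (f : ℤ → ℤ → ℤ → ℤ → ℤ) {p p′ a a′ b b′ q q′} → p ≡ p′ → a ≡ a′ → b ≡ b′ → q ≡ q′ → f p a b q ≡ f p′ a′ b′ q′
        cong₄ f refl refl refl refl = refl

        zero-case : ∀ u v w → 0ℤ * u ≡ 0ℤ * v - 0ℤ * w
        zero-case = solve-∀
        plus-case : ∀ {u v} w → u ≡ v → 1ℤ * u ≡ 1ℤ * v - 0ℤ * w
        plus-case {u} w refl = lemma u w
          where
          lemma : ∀ u w → 1ℤ * u ≡ 1ℤ * u - 0ℤ * w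
          lemma = solve-∀
        minus-case : ∀ {u w} v → u ≡ w → - 1ℤ * u ≡ 0ℤ * v - 1ℤ * w
        minus-case {u} v refl = lemma u v
          where
          lemma : ∀ u v → - 1ℤ * u ≡ 0ℤ * v - 1ℤ * u
          lemma = solve-∀
        00+ : ∀ a → a ≡ 0ℤ + (0ℤ + a)
        00+ = solve-∀
        10+ : ∀ a → a ≡ 1ℤ + (0ℤ + a) - 1ℤ
        10+ = solve-∀
        01+ : ∀ a → a ≡ 0ℤ + (1ℤ + a) - 1ℤ
        01+ = solve-∀

        module _ (f : ℤ → ℤ → ℤ → ℤ → ℤ) (p a b q : ℤ) where

          -- Here `p`, `a`, `b`, `q` count the coordinates other than i and j. Adding the
          -- contributions of i and j restores the counts over the whole list, and the decrements
          -- are those in the recursion of `spherical`.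
          plus-args minus-args : (xᵢ yᵢ xⱼ yⱼ : Bool) → ℤ
          plus-args xᵢ yᵢ xⱼ yⱼ =
            f (⟦ xᵢ ∧ yᵢ ⟧ + (⟦ xⱼ ∧ yⱼ ⟧ + p) - 1ℤ) (⟦ xᵢ ∧ not yᵢ ⟧ + (⟦ xⱼ ∧ not yⱼ ⟧ + a))
              (⟦ not xᵢ ∧ yᵢ ⟧ + (⟦ not xⱼ ∧ yⱼ ⟧ + b)) (⟦ not xᵢ ∧ not yᵢ ⟧ + (⟦ not xⱼ ∧ not yⱼ ⟧ + q) - 1ℤ)
          minus-args xᵢ yᵢ xⱼ yⱼ =
            f (⟦ xᵢ ∧ yᵢ ⟧ + (⟦ xⱼ ∧ yⱼ ⟧ + p)) (⟦ xᵢ ∧ not yᵢ ⟧ + (⟦ xⱼ ∧ not yⱼ ⟧ + a) - 1ℤ)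
              (⟦ not xᵢ ∧ yᵢ ⟧ + (⟦ not xⱼ ∧ yⱼ ⟧ + b) - 1ℤ) (⟦ not xᵢ ∧ not yᵢ ⟧ + (⟦ not xⱼ ∧ not yⱼ ⟧ + q))

          vanish : ∀ xᵢ yᵢ xⱼ yⱼ → 0ℤ * f p a b q ≡ 0ℤ * plus-args xᵢ yᵢ xⱼ yⱼ - 0ℤ * minus-args xᵢ yᵢ xⱼ yⱼ
          vanish xᵢ yᵢ xⱼ yⱼ = zero-case (f p a b q) (plus-args xᵢ yᵢ xⱼ yⱼ) (minus-args xᵢ yᵢ xⱼ yⱼ)

          -- The product of differences is 1 if one of i, j lies in both vectors and the other in
          -- neither, and -1 if one lies only in the first and the other only in the second. In all
          -- other cases it is 0.
          pair-term : ∀ xᵢ yᵢ xⱼ yⱼ →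
            (⟦ xᵢ ⟧ - ⟦ xⱼ ⟧) * (⟦ yᵢ ⟧ - ⟦ yⱼ ⟧) * f p a b q ≡
            (⟦ xᵢ ∧ yᵢ ⟧ * ⟦ not xⱼ ∧ not yⱼ ⟧ + ⟦ not xᵢ ∧ not yᵢ ⟧ * ⟦ xⱼ ∧ yⱼ ⟧) * plus-args xᵢ yᵢ xⱼ yⱼ
            - (⟦ xᵢ ∧ not yᵢ ⟧ * ⟦ not xⱼ ∧ yⱼ ⟧ + ⟦ not xᵢ ∧ yᵢ ⟧ * ⟦ xⱼ ∧ not yⱼ ⟧) * minus-args xᵢ yᵢ xⱼ yⱼ
          pair-term true true true true = vanish true true true true
          pair-term true true true false = vanish true true true false
          pair-term true true false true = vanish true true false true
          pair-term true true false false = plus-case (minus-args true true false false) (cong₄ f (10+ p) (00+ a) (00+ b) (01+ q))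
          pair-term true false true true = vanish true false true true
          pair-term true false true false = vanish true false true false
          pair-term true false false true = minus-case (plus-args true false false true) (cong₄ f (00+ p) (10+ a) (01+ b) (00+ q))
          pair-term true false false false = vanish true false false false
          pair-term false true true true = vanish false true true true
          pair-term false true true false = minus-case (plus-args false true true false) (cong₄ f (00+ p) (01+ a) (10+ b) (00+ q))
          pair-term false true false true = vanish false true false true
          pair-term false true false false = vanish false true false false
          pair-term false false true true = plus-case (minus-args false false true true) (cong₄ f (01+ p) (00+ a) (00+ b) (10+ q))
          pair-term false false true false = vanish false false true false
          pair-term false false false true = vanish false false false true
          pair-term false false false false = vanish false false false false

      -- By `pair-term` a drawn pair contributes only if it joins `both` to `neither` or `onlyˡ` to
      -- `onlyʳ`, and the rest of the kernel then depends on the decremented counts alone. Such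
      -- pairs number `P * Q` and `A′ * B′` in each order, whence the factor 2.
      kernel-spherical : ∀ k L → kernel k L x y ≡ spherical k (∑ L both) (∑ L onlyˡ) (∑ L onlyʳ) (∑ L neither)
      kernel-spherical zero    L = refl
      kernel-spherical (suc k) L = begin
        ∑ (picks L) (λ (i , L′) → ∑ (picks L′) λ (j , L″) → (bit x i - bit x j) * (bit y i - bit y j) * kernel k L″ x y)
          ≡⟨ ∑-cong-∈ (picks L) (λ {(i , L′)} i∈ → ∑-cong-∈ (picks L′) λ {(j , L″)} j∈ →
               step i j L″ (↭-trans (picks-↭ L i∈) (prep i (picks-↭ L′ j∈)))) ⟩
        ∑ (picks L) (λ (i , L′) → ∑ (picks L′) λ (j , L″) →
          ((U * (both i * neither j) + U * (neither i * both j)) + (V * (onlyˡ i * onlyʳ j) + V * (onlyʳ i * onlyˡ j))))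
          ≡⟨ ∑²-+ (λ i j → U * (both i * neither j) + U * (neither i * both j)) (λ i j → V * (onlyˡ i * onlyʳ j) + V * (onlyʳ i * onlyˡ j)) ⟩
        ∑² (λ i j → U * (both i * neither j) + U * (neither i * both j)) + ∑² (λ i j → V * (onlyˡ i * onlyʳ j) + V * (onlyʳ i * onlyˡ j))
          ≡⟨ cong₂ _+_ (∑²-+ (λ i j → U * (both i * neither j)) (λ i j → U * (neither i * both j)))
                       (∑²-+ (λ i j → V * (onlyˡ i * onlyʳ j)) (λ i j → V * (onlyʳ i * onlyˡ j))) ⟩
        (∑² (λ i j → U * (both i * neither j)) + ∑² (λ i j → U * (neither i * both j)))
         + (∑² (λ i j → V * (onlyˡ i * onlyʳ j)) + ∑² (λ i j → V * (onlyʳ i * onlyˡ j)))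
          ≡⟨ cong₂ _+_ (cong₂ _+_ (∑²-* U both neither disjoint₁) (∑²-* U neither both (λ i → trans (*-comm (neither i) (both i)) (disjoint₁ i))))
                       (cong₂ _+_ (∑²-* V onlyˡ onlyʳ disjoint₂) (∑²-* V onlyʳ onlyˡ (λ i → trans (*-comm (onlyʳ i) (onlyˡ i)) (disjoint₂ i)))) ⟩
        (U * (P * Q) + U * (Q * P)) + (V * (A′ * B′) + V * (B′ * A′))
          ≡⟨ collect U P Q A′ B′ (spherical k P (A′ - 1ℤ) (B′ - 1ℤ) Q) ⟩
        + 2 * (P * Q * U - A′ * B′ * spherical k P (A′ - 1ℤ) (B′ - 1ℤ) Q) ∎
        where
        P = ∑ L both
        A′ = ∑ L onlyˡ
        B′ = ∑ L onlyʳ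
        Q = ∑ L neither
        U = spherical k (P - 1ℤ) A′ B′ (Q - 1ℤ)
        V = - spherical k P (A′ - 1ℤ) (B′ - 1ℤ) Q
        ∑² : (Fin n → Fin n → ℤ) → ℤ
        ∑² f = ∑ (picks L) λ (i , L′) → ∑ (picks L′) λ (j , L″) → f i j
        ∑²-+ : ∀ f g → ∑² (λ i j → f i j + g i j) ≡ ∑² f + ∑² g
        ∑²-+ f g = trans (∑-cong (picks L) (λ (i , L′) → ∑-+ (picks L′) (λ (j , _) → f i j) (λ (j , _) → g i j))) (∑-+ (picks L) _ _)
        ∑²-* : ∀ u (f g : Fin n → ℤ) → (∀ i → f i * g i ≡ 0ℤ) → ∑² (λ i j → u * (f i * g j)) ≡ u * (∑ L f * ∑ L g)
        ∑²-* u f g fg≡0 = trans (∑-cong (picks L) (λ (i , L′) → ∑-*ˡ (picks L′) u (λ (j , _) → f i * g j)))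
          (trans (∑-*ˡ (picks L) u _) (cong (u *_) (∑-picks² L f g fg≡0)))
        collect : ∀ u p q a b v → (u * (p * q) + u * (q * p)) + (- v * (a * b) + - v * (b * a)) ≡ + 2 * (p * q * u - a * b * v)
        collect = solve-∀
        split : ∀ u v a b c d → (a + b) * u - (c + d) * v ≡ (u * a + u * b) + (- v * c + - v * d)
        split = solve-∀
        step : ∀ i j L″ → L ↭ i ∷ j ∷ L″ → (bit x i - bit x j) * (bit y i - bit y j) * kernel k L″ x y ≡
               (U * (both i * neither j) + U * (neither i * both j)) + (V * (onlyˡ i * onlyʳ j) + V * (onlyʳ i * onlyˡ j))
        step i j L″ L↭ = begin
          (bit x i - bit x j) * (bit y i - bit y j) * kernel k L″ x y
            ≡⟨ cong ((bit x i - bit x j) * (bit y i - bit y j) *_) (kernel-spherical k L″) ⟩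
          (bit x i - bit x j) * (bit y i - bit y j) * spherical k (∑ L″ both) (∑ L″ onlyˡ) (∑ L″ onlyʳ) (∑ L″ neither)
            ≡⟨ pair-term (spherical k) (∑ L″ both) (∑ L″ onlyˡ) (∑ L″ onlyʳ) (∑ L″ neither)
                 (lookup x i) (lookup y i) (lookup x j) (lookup y j) ⟩
          _ ≡⟨ cong₄ (λ p a b q → (both i * neither j + neither i * both j) * spherical k (p - 1ℤ) a b (q - 1ℤ)
                                  - (onlyˡ i * onlyʳ j + onlyʳ i * onlyˡ j) * spherical k p (a - 1ℤ) (b - 1ℤ) q)
                 (sym (∑-↭ both L↭)) (sym (∑-↭ onlyˡ L↭)) (sym (∑-↭ onlyʳ L↭)) (sym (∑-↭ neither L↭)) ⟩
          (both i * neither j + neither i * both j) * U - (onlyˡ i * onlyʳ j + onlyʳ i * onlyˡ j) * spherical k P (A′ - 1ℤ) (B′ - 1ℤ) Q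
            ≡⟨ split U (spherical k P (A′ - 1ℤ) (B′ - 1ℤ) Q) (both i * neither j) (neither i * both j) (onlyˡ i * onlyʳ j) (onlyʳ i * onlyˡ j) ⟩
          _ ∎

  -- Spherical functions of the Johnson scheme

  ∑-allFin : ∀ {n} (f : Fin (suc n) → ℤ) → ∑ (allFin (suc n)) f ≡ f zero + ∑ (allFin n) (f ∘ suc)
  ∑-allFin {n} f = cong (_+_ (f zero)) (trans (cong (λ l → ∑ l f) (sym (map-tabulate id suc))) (∑-map suc (allFin n) f))

  ∑-1 : ∀ (xs : List A) → ∑ xs (λ _ → 1ℤ) ≡ + length xs
  ∑-1 []       = refl
  ∑-1 (x ∷ xs) = cong (_+_ 1ℤ) (∑-1 xs)

  dimension-∑ : ∀ n → + n ≡ ∑ (allFin n) (λ _ → 1ℤ)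
  dimension-∑ zero    = refl
  dimension-∑ (suc n) = trans (cong (_+_ 1ℤ) (dimension-∑ n)) (sym (∑-allFin {n} (λ _ → 1ℤ)))

  weight-∑ : ∀ (x : Vec Bool n) → + weight x ≡ ∑ (allFin n) (bit x)
  weight-∑ []      = refl
  weight-∑ (b ∷ x) = trans (cong₂ _+_ (head b) (weight-∑ x)) (sym (∑-allFin (bit (b ∷ x))))
    where
    head : ∀ b → + (if b then 1 else 0) ≡ ⟦ b ⟧
    head true  = refl
    head false = refl

  hamming-∑ : ∀ (x y : Vec Bool n) → + hamming x y ≡ ∑ (allFin n) (λ i → onlyˡ x y i + onlyʳ x y i)
  hamming-∑ []      []      = refl
  hamming-∑ (a ∷ x) (b ∷ y) =
    trans (cong₂ _+_ (head a b) (hamming-∑ x y)) (sym (∑-allFin (λ i → onlyˡ (a ∷ x) (b ∷ y) i + onlyʳ (a ∷ x) (b ∷ y) i)))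
    where
    head : ∀ a b → + (if a xor b then 1 else 0) ≡ ⟦ a ∧ not b ⟧ + ⟦ not a ∧ b ⟧
    head true  true  = refl
    head true  false = refl
    head false true  = refl
    head false false = refl

  hamming-refl : ∀ (x : Vec Bool n) → hamming x x ≡ 0
  hamming-refl []          = refl
  hamming-refl (true ∷ x)  = hamming-refl x
  hamming-refl (false ∷ x) = hamming-refl x

  hamming≡0⇒≡ : ∀ (x y : Vec Bool n) → hamming x y ≡ 0 → x ≡ y
  hamming≡0⇒≡ []          []          eq = refl
  hamming≡0⇒≡ (true ∷ x)  (true ∷ y)  eq = cong (true ∷_) (hamming≡0⇒≡ x y eq)
  hamming≡0⇒≡ (false ∷ x) (false ∷ y) eq = cong (false ∷_) (hamming≡0⇒≡ x y eq)

  τ-refl : ∀ (x : Vec Bool n) → τ x x ≡ 0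
  τ-refl x = cong ℕ.⌊_/2⌋ (hamming-refl x)

  ⟦⟧-≥0 : ∀ b → 0ℤ ≤ ⟦ b ⟧
  ⟦⟧-≥0 true  = +≤+ z≤n
  ⟦⟧-≥0 false = ≤-refl

  module _ {w : ℕ} (x y : Vec Bool n) (wx : weight x ≡ w) (wy : weight y ≡ w) where
    open ≡-Reasoning

    private
      L = allFin n
      p = ∑ L (both x y)
      a = ∑ L (onlyˡ x y)
      b = ∑ L (onlyʳ x y)
      q = ∑ L (neither x y)

      p+a≡w : p + a ≡ + w
      p+a≡w = begin
        p + a                                      ≡⟨ sym (∑-+ L (both x y) (onlyˡ x y)) ⟩
        ∑ L (λ i → both x y i + onlyˡ x y i)       ≡⟨ ∑-cong L (λ i → pointwise (lookup x i) (lookup y i)) ⟩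
        ∑ L (bit x)                                ≡⟨ sym (weight-∑ x) ⟩
        + weight x                                 ≡⟨ cong +_ wx ⟩
        + w                                        ∎
        where
        pointwise : ∀ u v → ⟦ u ∧ v ⟧ + ⟦ u ∧ not v ⟧ ≡ ⟦ u ⟧
        pointwise true  true  = refl
        pointwise true  false = refl
        pointwise false v     = refl

      p+b≡w : p + b ≡ + w
      p+b≡w = begin
        p + b                                      ≡⟨ sym (∑-+ L (both x y) (onlyʳ x y)) ⟩
        ∑ L (λ i → both x y i + onlyʳ x y i)       ≡⟨ ∑-cong L (λ i → pointwise (lookup x i) (lookup y i)) ⟩
        ∑ L (bit y)                                ≡⟨ sym (weight-∑ y) ⟩
        + weight y                                 ≡⟨ cong +_ wy ⟩
        + w                                        ∎
        where
        pointwise : ∀ u v → ⟦ u ∧ v ⟧ + ⟦ not u ∧ v ⟧ ≡ ⟦ v ⟧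
        pointwise true  true  = refl
        pointwise true  false = refl
        pointwise false true  = refl
        pointwise false false = refl

      total : p + a + (b + q) ≡ + n
      total = begin
        p + a + (b + q)
          ≡⟨ cong₂ _+_ (sym (∑-+ L (both x y) (onlyˡ x y))) (sym (∑-+ L (onlyʳ x y) (neither x y))) ⟩
        ∑ L (λ i → both x y i + onlyˡ x y i) + ∑ L (λ i → onlyʳ x y i + neither x y i)
          ≡⟨ sym (∑-+ L _ _) ⟩
        ∑ L (λ i → both x y i + onlyˡ x y i + (onlyʳ x y i + neither x y i))
          ≡⟨ ∑-cong L (λ i → pointwise (lookup x i) (lookup y i)) ⟩
        ∑ L (λ _ → 1ℤ) ≡⟨ sym (dimension-∑ n) ⟩
        + n            ∎
        where
        pointwise : ∀ u v → ⟦ u ∧ v ⟧ + ⟦ u ∧ not v ⟧ + (⟦ not u ∧ v ⟧ + ⟦ not u ∧ not v ⟧) ≡ 1ℤ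
        pointwise true  true  = refl
        pointwise true  false = refl
        pointwise false true  = refl
        pointwise false false = refl

      b≡a : b ≡ a
      b≡a = +-cancelˡ-≡ p b a (trans p+b≡w (sym p+a≡w))
        where
        +-cancelˡ-≡ : ∀ i j k → i + j ≡ i + k → j ≡ k
        +-cancelˡ-≡ i j k eq = trans (lemma i j) (trans (cong (λ s → - i + s) eq) (sym (lemma i k)))
          where
          lemma : ∀ i j → j ≡ - i + (i + j)
          lemma = solve-∀

      hamming≡2a : hamming x y ≡ ∣ a ∣ ℕ.+ ∣ a ∣
      hamming≡2a = +-injective (begin
        + hamming x y           ≡⟨ hamming-∑ x y ⟩
        _                       ≡⟨ ∑-+ L (onlyˡ x y) (onlyʳ x y) ⟩
        a + b                   ≡⟨ cong (_+_ a) b≡a ⟩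
        a + a                   ≡⟨ cong₂ _+_ (sym +∣a∣) (sym +∣a∣) ⟩
        + ∣ a ∣ + + ∣ a ∣       ∎)
        where
        +∣a∣ : + ∣ a ∣ ≡ a
        +∣a∣ = 0≤i⇒+∣i∣≡i (∑-≥0 L (λ i → ⟦⟧-≥0 (lookup x i ∧ not (lookup y i))))

    -- Vectors of equal weight have equally many ones of their own, so the Hamming distance is even
    -- and the halving in `τ` is exact.
    hamming≡τ+τ : hamming x y ≡ τ x y ℕ.+ τ x y
    hamming≡τ+τ = trans hamming≡2a (cong₂ ℕ._+_ ∣a∣≡τ ∣a∣≡τ)
      where
      ∣a∣≡τ : ∣ a ∣ ≡ τ x y
      ∣a∣≡τ = trans (ℕₚ.n≡⌊n+n/2⌋ ∣ a ∣) (cong ℕ.⌊_/2⌋ (sym hamming≡2a))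

    onlyˡ-count : ∑ (allFin n) (onlyˡ x y) ≡ + τ x y
    onlyˡ-count = begin
      a       ≡⟨ sym (0≤i⇒+∣i∣≡i (∑-≥0 L (λ i → ⟦⟧-≥0 (lookup x i ∧ not (lookup y i))))) ⟩
      + ∣ a ∣ ≡⟨ cong +_ (trans (ℕₚ.n≡⌊n+n/2⌋ ∣ a ∣) (cong ℕ.⌊_/2⌋ (sym hamming≡2a))) ⟩
      + τ x y ∎

    onlyʳ-count : ∑ (allFin n) (onlyʳ x y) ≡ + τ x y
    onlyʳ-count = trans b≡a onlyˡ-count

    both-count : ∑ (allFin n) (both x y) ≡ + w - + τ x y
    both-count = begin
      p           ≡⟨ lemma p a ⟩
      p + a - a   ≡⟨ cong₂ _-_ p+a≡w onlyˡ-count ⟩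
      + w - + τ x y ∎
      where
      lemma : ∀ p a → p ≡ p + a - a
      lemma = solve-∀

    neither-count : ∑ (allFin n) (neither x y) ≡ + n - + w - + τ x y
    neither-count = begin
      q                             ≡⟨ lemma p a b q ⟩
      p + a + (b + q) - (p + a) - b ≡⟨ cong₂ _-_ (cong₂ _-_ total p+a≡w) onlyʳ-count ⟩
      + n - + w - + τ x y           ∎
      where
      lemma : ∀ p a b q → q ≡ p + a + (b + q) - (p + a) - b
      lemma = solve-∀

    τ≤w : τ x y ℕ.≤ w
    τ≤w = drop‿+≤+ (subst (_≤ + w) onlyˡ-count (subst (a ≤_) p+a≡w
      (subst (_≤ p + a) (+-identityˡ a) (+-monoˡ-≤ a (∑-≥0 L (λ i → ⟦⟧-≥0 (lookup x i ∧ lookup y i)))))))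

    τ≡0⇒≡ : τ x y ≡ 0 → x ≡ y
    τ≡0⇒≡ eq = hamming≡0⇒≡ x y (trans hamming≡τ+τ (cong₂ ℕ._+_ eq eq))

  -- Up to a scalar, the Hahn polynomial of degree `k` at `d`, which is the zonal spherical function
  -- of the Johnson scheme. The four arguments are the counts for two words of weight `w` at
  -- distance `d`.
  johnson : (n w k d : ℕ) → ℤ
  johnson n w k d = spherical k (+ w - + d) (+ d) (+ d) (+ n - + w - + d)

  kernel-johnson : ∀ {w} (x y : Vec Bool n) → weight x ≡ w → weight y ≡ w → ∀ k →
                   kernel k (allFin n) x y ≡ johnson n w k (τ x y)
  kernel-johnson {n} x y wx wy k
    rewrite kernel-spherical x y k (allFin n) | both-count x y wx wy | onlyˡ-count x y wx wy
          | onlyʳ-count x y wx wy | neither-count x y wx wy = refl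

  -- Expansions in spherical functions and the linear programming bound

  Expansion : Set
  Expansion = List (ℤ × ℕ)

  Triple Coefficients : Set
  Triple       = ℕ × ℕ × ℕ
  Coefficients = ℤ × ℤ × ℤ × ℤ

  -- Four coefficients always allow a nonzero solution of the three conditions that the value vanish
  -- at three distances.
  expansion : Triple → Coefficients → Expansion
  expansion (k₁ , k₂ , k₃) (f₀ , f₁ , f₂ , f₃) = (f₀ , 0) ∷ (f₁ , k₁) ∷ (f₂ , k₂) ∷ (f₃ , k₃) ∷ []

  value : (n w : ℕ) → Expansion → ℕ → ℤ
  value n w F d = ∑ F (λ (f , k) → f * johnson n w k d)

  module _ {w : ℕ} {X : List (Vec Bool n)} (wX : All (λ x → weight x ≡ w) X) where
    open ≡-Reasoning

    energy-expansion : ∀ F c → ∑ F (λ (f , k) → f * energy X k (allFin n) c) ≡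
                       ∑ X (λ x → ∑ X (λ y → c x * c y * value n w F (τ x y)))
    energy-expansion F c = begin
      ∑ F (λ (f , k) → f * energy X k (allFin n) c)
        ≡⟨ ∑-cong F (λ (f , k) → trans (cong (f *_) (energy-kernel X k (allFin n) c))
             (trans (sym (∑-*ˡ X f _)) (∑-cong-∈ X λ {x} x∈ → trans (sym (∑-*ˡ X f _)) (∑-cong-∈ X λ {y} y∈ →
               trans (cong (λ z → f * (c x * c y * z)) (kernel-johnson x y (All.lookup wX x∈) (All.lookup wX y∈) k))
                     (exchange f (c x * c y) (johnson n w k (τ x y))))))) ⟩
      ∑ F (λ (f , k) → ∑ X (λ x → ∑ X (λ y → c x * c y * (f * johnson n w k (τ x y)))))
        ≡⟨ trans (∑-swap F X _) (∑-cong X λ x → ∑-swap F X _) ⟩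
      ∑ X (λ x → ∑ X (λ y → ∑ F (λ (f , k) → c x * c y * (f * johnson n w k (τ x y)))))
        ≡⟨ ∑∑-cong X (λ x y → ∑-*ˡ F (c x * c y) _) ⟩
      ∑ X (λ x → ∑ X (λ y → c x * c y * value n w F (τ x y))) ∎
      where
      exchange : ∀ a b c → a * (b * c) ≡ b * (a * c)
      exchange = solve-∀

    -- Only the diagonal of the quadratic form survives, since `F` vanishes at every distance
    -- between distinct words.
    energy-annihilator : ∀ F c → Unique X → (∀ {x y} → x ∈ X → y ∈ X → x ≢ y → value n w F (τ x y) ≡ 0ℤ) →
      ∑ F (λ (f , k) → f * energy X k (allFin n) c) ≡ ∑ X (λ x → c x * c x) * value n w F 0
    energy-annihilator F c uX F≡0 = begin
      ∑ F (λ (f , k) → f * energy X k (allFin n) c)            ≡⟨ energy-expansion F c ⟩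
      ∑ X (λ x → ∑ X (λ y → c x * c y * value n w F (τ x y)))
        ≡⟨ ∑-cong-∈ X (λ {x} x∈ → ∑-single uX x∈ (λ {y} y∈ x≢y →
             trans (cong (c x * c y *_) (F≡0 x∈ y∈ x≢y)) (*-zeroʳ (c x * c y)))) ⟩
      ∑ X (λ x → c x * c x * value n w F (τ x x))
        ≡⟨ ∑-cong X (λ x → cong (λ d → c x * c x * value n w F d) (τ-refl x)) ⟩
      ∑ X (λ x → c x * c x * value n w F 0)                    ≡⟨ ∑-*ʳ X (value n w F 0) (λ x → c x * c x) ⟩
      ∑ X (λ x → c x * c x) * value n w F 0                    ∎

  module _ {w : ℕ} {X : List (Vec Bool n)} (wX : All (λ x → weight x ≡ w) X) (uX : Unique X) where

    -- With the weighting 1 the energy of degree 0 is the square of the size of `X`, and the other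
    -- terms are nonnegative. Comparing `F` at 0 with `suc T` times the leading coefficient,
    -- strictly, expresses that `T` is at least the floor of the quotient.
    linear-programming-bound : ∀ f₀ G T → let F = (+ suc f₀ , 0) ∷ G in
      All (λ (f , _) → 0ℤ ≤ f) G →
      (∀ {x y} → x ∈ X → y ∈ X → x ≢ y → value n w F (τ x y) ≡ 0ℤ) →
      value n w F 0 < + suc f₀ * + suc T →
      length X ℕ.≤ T
    linear-programming-bound f₀ G T G≥0 F≡0 F0< with length X ℕₚ.≤? T
    ... | yes le = le
    ... | no nle = contradiction chain (<-irrefl refl)
      where
      F = (+ suc f₀ , 0) ∷ G
      N = + length X
      one : Vec Bool n → ℤ
      one _ = 1ℤ
      N>T : + suc T ≤ N
      N>T = +≤+ (ℕₚ.≰⇒> nle)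
      instance
        N-pos : Positive N
        N-pos = positive (<-≤-trans (+<+ (s≤s z≤n)) N>T)
      rest : ∀ G → All (λ (f , _) → 0ℤ ≤ f) G → 0ℤ ≤ ∑ G (λ (f , k) → f * energy X k (allFin n) one)
      rest [] [] = ≤-refl
      rest ((f , k) ∷ G) (f≥0 ∷ G≥0) = +-mono-≤
        (subst (_≤ f * energy X k (allFin n) one) (*-zeroʳ f)
          (*-monoˡ-≤-nonNeg f {{nonNegative f≥0}} (energy-≥0 X k (allFin n) one))) (rest G G≥0)
      open ≤-Reasoning
      chain : + suc f₀ * N * N < + suc f₀ * N * N
      chain = begin-strict
        + suc f₀ * N * N                   ≡⟨ *-assoc (+ suc f₀) N N ⟩
        + suc f₀ * (N * N)                 ≡⟨ cong (λ z → + suc f₀ * (z * z)) (sym (∑-1 X)) ⟩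
        + suc f₀ * (∑ X one * ∑ X one)     ≡⟨ sym (+-identityʳ _) ⟩
        + suc f₀ * (∑ X one * ∑ X one) + 0ℤ ≤⟨ +-monoʳ-≤ (+ suc f₀ * (∑ X one * ∑ X one)) (rest G G≥0) ⟩
        ∑ F (λ (f , k) → f * energy X k (allFin n) one) ≡⟨ energy-annihilator wX F one uX F≡0 ⟩
        ∑ X (λ _ → 1ℤ * 1ℤ) * value n w F 0 ≡⟨ cong (_* value n w F 0) (∑-1 X) ⟩
        N * value n w F 0                  <⟨ *-monoˡ-<-pos N F0< ⟩
        N * (+ suc f₀ * + suc T)           ≤⟨ *-monoˡ-≤-nonNeg N (*-monoˡ-≤-nonNeg (+ suc f₀) N>T) ⟩
        N * (+ suc f₀ * N)                 ≡⟨ *-comm N (+ suc f₀ * N) ⟩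
        + suc f₀ * N * N                   ∎

  -- Integrality of the ratios

  pairs : ∀ n → List (Fin n × Fin n)
  pairs zero    = []
  pairs (suc n) = map (λ j → zero , suc j) (allFin n) ++ map (λ (i , j) → suc i , suc j) (pairs n)

  length-allFin : ∀ n → length (allFin n) ≡ n
  length-allFin n = length-tabulate id

  length-pairs : ∀ n → length (pairs n) ≡ n C 2
  length-pairs zero    = refl
  length-pairs (suc n) = begin
    length (pairs (suc n))                                        ≡⟨ length-++ (map (λ j → zero , suc j) (allFin n)) ⟩
    length (map (λ j → zero , suc j) (allFin n)) ℕ.+ length (map (λ (i , j) → suc i , suc j) (pairs n))
      ≡⟨ cong₂ ℕ._+_ (trans (length-map _ (allFin n)) (length-allFin n)) (trans (length-map _ (pairs n)) (length-pairs n)) ⟩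
    n ℕ.+ n C 2                                                   ≡⟨ cong (ℕ._+ n C 2) (sym (nC1≡n n)) ⟩
    n C 1 ℕ.+ n C 2                                               ≡⟨ nCk+nC[k+1]≡[n+1]C[k+1] n 1 ⟩
    suc n C 2                                                     ∎
    where open ≡-Reasoning

  ∈-pairs : ∀ {i j : Fin n} → i Fin.< j → (i , j) ∈ pairs n
  ∈-pairs {suc n} {zero}  {suc j} _         = ∈-++⁺ˡ (∈-map⁺ _ (∈-allFin j))
  ∈-pairs {suc n} {suc i} {suc j} (s≤s i<j) = ∈-++⁺ʳ (map (λ j → zero , suc j) (allFin n)) (∈-map⁺ _ (∈-pairs i<j))

  -- `Q′` is `Q` in the lowest terms of the fraction P / Q: it exceeds 1 because the fraction is no
  -- integer, and it is coprime to the reduced numerator.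
  cofactor : ∀ P Q → Q ≢ 0 → ¬ (Q ∣ P) → ∃ λ Q′ → 1 ℕ.< Q′ × (∀ m t → m ℕ.* P ≡ Q ℕ.* t → Q′ ∣ m)
  cofactor P Q Q≢0 Q∤P = Q′ , Q′>1 , Q′∣
    where
    g = gcd P Q
    instance
      g-nonZero : ℕ.NonZero g
      g-nonZero = ℕ.≢-nonZero (gcd[m,n]≢0 P Q (inj₂ Q≢0))
    P′ = P / g
    Q′ = Q / g
    P≡ : P′ ℕ.* g ≡ P
    P≡ = m/n*n≡m (gcd[m,n]∣m P Q)
    Q≡ : Q′ ℕ.* g ≡ Q
    Q≡ = m/n*n≡m (gcd[m,n]∣n P Q)
    Q′>1 : 1 ℕ.< Q′
    Q′>1 = ℕₚ.≤∧≢⇒< (ℕₚ.n≢0⇒n>0 (λ Q′≡0 → Q≢0 (trans (sym Q≡) (cong (ℕ._* g) Q′≡0))))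
      (λ 1≡Q′ → Q∤P (subst (_∣ P) (trans (sym (ℕₚ.*-identityˡ g)) (trans (cong (ℕ._* g) 1≡Q′) Q≡)) (gcd[m,n]∣m P Q)))
    Q′∣ : ∀ m t → m ℕ.* P ≡ Q ℕ.* t → Q′ ∣ m
    Q′∣ m t eq = coprime-divisor (Coprimality.sym (coprime-/gcd P Q)) (divides t (ℕₚ.*-cancelʳ-≡ _ _ g (begin
      P′ ℕ.* m ℕ.* g     ≡⟨ trans (cong (ℕ._* g) (ℕₚ.*-comm P′ m)) (ℕₚ.*-assoc m P′ g) ⟩
      m ℕ.* (P′ ℕ.* g)   ≡⟨ cong (m ℕ.*_) P≡ ⟩
      m ℕ.* P            ≡⟨ eq ⟩
      Q ℕ.* t            ≡⟨ cong (ℕ._* t) (sym Q≡) ⟩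
      Q′ ℕ.* g ℕ.* t     ≡⟨ ℕₚ.*-comm (Q′ ℕ.* g) t ⟩
      t ℕ.* (Q′ ℕ.* g)   ≡⟨ sym (ℕₚ.*-assoc t Q′ g) ⟩
      t ℕ.* Q′ ℕ.* g     ∎)))
      where open ≡-Reasoning

  i*j≡0⇒j≡0 : ∀ i {j} → i ≢ 0ℤ → i * j ≡ 0ℤ → j ≡ 0ℤ
  i*j≡0⇒j≡0 i i≢0 eq with i*j≡0⇒i≡0∨j≡0 i eq
  ... | inj₁ i≡0 = contradiction i≡0 i≢0
  ... | inj₂ j≡0 = j≡0

  i≢0∧j≢0⇒i*j≢0 : ∀ i j → i ≢ 0ℤ → j ≢ 0ℤ → i * j ≢ 0ℤ
  i≢0∧j≢0⇒i*j≢0 i j i≢0 j≢0 eq = j≢0 (i*j≡0⇒j≡0 i i≢0 eq)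

  module _ {w : ℕ} {X : List (Vec Bool n)} (wX : All (λ x → weight x ≡ w) X) (uX : Unique X) where

    private
      L = allFin n

      -- The case `i = j` contains the linear moments, since bits are idempotent.
      Solution : (Vec Bool n → ℤ) → Set
      Solution c = ∀ i j → ∑ X (λ x → c x * (bit x i * bit x j)) ≡ 0ℤ

      -- The inner product of two words is `w` minus their distance. The factor `w` makes the form
      -- homogeneous: a constant times `w` is that constant times the sum of the bits of `x`.
      linear : ∀ r {x y} → x ∈ X → y ∈ X → 
               + w * (+ r - + τ x y) ≡ ∑ L (λ i → bit x i * (+ w * bit y i - (+ w - + r)))
      linear r {x} {y} x∈ y∈ = sym (begin
        ∑ L (λ i → bit x i * (+ w * bit y i - (+ w - + r)))
          ≡⟨ ∑-cong L (λ i → trans (ring₁ (bit x i) (bit y i) (+ w) (+ r)) (cong (λ z → + w * z + (+ r - + w) * bit x i) (product (lookup x i) (lookup y i)))) ⟩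
        ∑ L (λ i → + w * both x y i + (+ r - + w) * bit x i)
          ≡⟨ trans (∑-+ L _ _) (cong₂ _+_ (∑-*ˡ L (+ w) (both x y)) (∑-*ˡ L (+ r - + w) (bit x))) ⟩
        + w * ∑ L (both x y) + (+ r - + w) * ∑ L (bit x)
          ≡⟨ cong₂ (λ u v → + w * u + (+ r - + w) * v) (both-count x y (All.lookup wX x∈) (All.lookup wX y∈))
               (trans (sym (weight-∑ x)) (cong +_ (All.lookup wX x∈))) ⟩
        + w * (+ w - + τ x y) + (+ r - + w) * + w
          ≡⟨ ring₂ (+ w) (+ τ x y) (+ r) ⟩
        + w * (+ r - + τ x y) ∎)
        where
        open ≡-Reasoning
        ring₁ : ∀ a b w r → a * (w * b - (w - r)) ≡ w * (a * b) + (r - w) * a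
        ring₁ = solve-∀
        ring₂ : ∀ w t r → w * (w - t) + (r - w) * w ≡ w * (r - t)
        ring₂ = solve-∀
        product : ∀ a b → ⟦ a ⟧ * ⟦ b ⟧ ≡ ⟦ a ∧ b ⟧
        product true  true  = refl
        product true  false = refl
        product false true  = refl
        product false false = refl

      -- By `linear` the product of the two factors is a quadratic form in the bits of `x`, and `c`
      -- kills each of its monomials.
      quadratic : ∀ c → Solution c → ∀ r s {y} → y ∈ X →
                  + w * + w * ∑ X (λ x → c x * ((+ r - + τ x y) * (+ s - + τ x y))) ≡ 0ℤ
      quadratic c sol r s {y} y∈ = begin
        + w * + w * ∑ X (λ x → c x * ((+ r - + τ x y) * (+ s - + τ x y)))
          ≡⟨ sym (∑-*ˡ X (+ w * + w) _) ⟩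
        ∑ X (λ x → + w * + w * (c x * ((+ r - + τ x y) * (+ s - + τ x y))))
          ≡⟨ ∑-cong-∈ X (λ {x} x∈ → trans (ring₁ (+ w) (c x) (+ r - + τ x y) (+ s - + τ x y))
               (cong₂ (λ u v → c x * (u * v)) (linear r x∈ y∈) (linear s x∈ y∈))) ⟩
        ∑ X (λ x → c x * (∑ L (λ i → bit x i * U i) * ∑ L (λ j → bit x j * V j)))
          ≡⟨ ∑-cong X (λ x → trans (cong (c x *_) (trans (sym (∑-*ʳ L _ _)) (∑-cong L λ i →
                 sym (∑-*ˡ L (bit x i * U i) (λ j → bit x j * V j)))))
               (trans (sym (∑-*ˡ L (c x) _)) (∑-cong L λ i → trans (sym (∑-*ˡ L (c x) _)) (∑-cong L λ j →
                 ring₂ (c x) (bit x i) (U i) (bit x j) (V j))))) ⟩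
        ∑ X (λ x → ∑ L (λ i → ∑ L (λ j → U i * V j * (c x * (bit x i * bit x j)))))
          ≡⟨ trans (∑-swap X L _) (∑-cong L λ i → ∑-swap X L _) ⟩
        ∑ L (λ i → ∑ L (λ j → ∑ X (λ x → U i * V j * (c x * (bit x i * bit x j)))))
          ≡⟨ ∑-vanish L (λ {i} _ → ∑-vanish L λ {j} _ → trans (∑-*ˡ X (U i * V j) _)
               (trans (cong (U i * V j *_) (sol i j)) (*-zeroʳ (U i * V j)))) ⟩
        0ℤ ∎
        where
        open ≡-Reasoning
        U V : Fin n → ℤ
        U i = + w * bit y i - (+ w - + r)
        V i = + w * bit y i - (+ w - + s)
        ring₁ : ∀ w c a b → w * w * (c * (a * b)) ≡ c * ((w * a) * (w * b))
        ring₁ = solve-∀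
        ring₂ : ∀ c a u b v → c * ((a * u) * (b * v)) ≡ u * v * (c * (a * b))
        ring₂ = solve-∀

    private
      -- Off the diagonal `K` is a multiple of `q`, so modulo `q` the vanishing sum reduces to its
      -- term at `y`, which is `c y * p`.
      divisible : ∀ (p q : ℤ) (K m : ℕ → ℤ) → K 0 ≡ p →
        (∀ {x y} → x ∈ X → y ∈ X → x ≢ y → K (τ x y) ≡ q * m (τ x y)) →
        ∀ (c : Vec Bool n → ℤ) {y} → y ∈ X → ∑ X (λ x → c x * K (τ x y)) ≡ 0ℤ → ∃ λ t → c y * p ≡ q * t
      divisible p q K m K0 K≡qm c {y} y∈ ∑≡0 = c y * m (τ y y) - S , (begin
        c y * p                                             ≡⟨ cong (c y *_) (trans (sym K0) (cong K (sym (τ-refl y)))) ⟩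
        c y * K (τ y y)                                     ≡⟨ ring₁ (c y) (K (τ y y)) q (m (τ y y)) ⟩
        c y * R (τ y y) + q * (c y * m (τ y y))             ≡⟨ cong (λ z → z + q * (c y * m (τ y y))) (sym single) ⟩
        ∑ X (λ x → c x * R (τ x y)) + q * (c y * m (τ y y)) ≡⟨ cong (λ z → z + q * (c y * m (τ y y))) sum ⟩
        - q * S + q * (c y * m (τ y y))                     ≡⟨ ring₂ q S (c y * m (τ y y)) ⟩
        q * (c y * m (τ y y) - S)                           ∎)
        where
        open ≡-Reasoning
        S = ∑ X (λ x → c x * m (τ x y))
        R : ℕ → ℤ
        R t = K t - q * m t
        ring₁ : ∀ c k q m → c * k ≡ c * (k - q * m) + q * (c * m)
        ring₁ = solve-∀
        ring₂ : ∀ q s t → - q * s + q * t ≡ q * (t - s)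
        ring₂ = solve-∀
        ring₃ : ∀ c k q m → c * (k - q * m) ≡ c * k + - q * (c * m)
        ring₃ = solve-∀
        single : ∑ X (λ x → c x * R (τ x y)) ≡ c y * R (τ y y)
        single = ∑-single uX y∈ (λ {x} x∈ y≢x → trans
          (cong (c x *_) (i≡j⇒i-j≡0 (K≡qm x∈ y∈ (λ x≡y → y≢x (sym x≡y))))) (*-zeroʳ (c x)))
        sum : ∑ X (λ x → c x * R (τ x y)) ≡ - q * S
        sum = begin
          ∑ X (λ x → c x * R (τ x y))
            ≡⟨ ∑-cong X (λ x → ring₃ (c x) (K (τ x y)) q (m (τ x y))) ⟩
          ∑ X (λ x → c x * K (τ x y) + - q * (c x * m (τ x y)))
            ≡⟨ trans (∑-+ X _ _) (cong₂ _+_ ∑≡0 (∑-*ˡ X (- q) _)) ⟩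
          0ℤ + - q * S ≡⟨ +-identityˡ _ ⟩
          - q * S ∎

    private
      module Descent (p q : ℤ) (divisible-by : ∀ c → Solution c → ∀ {y} → y ∈ X → ∃ λ t → c y * p ≡ q * t)
          {Q′ : ℕ} (Q′>1 : 1 ℕ.< Q′) (Q′∣ : ∀ m t → m ℕ.* ∣ p ∣ ≡ ∣ q ∣ ℕ.* t → Q′ ∣ m) where

        instance
          Q′-nonZero : ℕ.NonZero Q′
          Q′-nonZero = ℕ.>-nonZero (ℕₚ.<-trans ℕₚ.≤-refl Q′>1)

        Q′∣c : ∀ c → Solution c → ∀ {y} → y ∈ X → Q′ ∣ ∣ c y ∣
        Q′∣c c sol {y} y∈ with divisible-by c sol y∈
        ... | t , eq = Q′∣ ∣ c y ∣ ∣ t ∣ (trans (sym (abs-* (c y) p)) (trans (cong ∣_∣ eq) (abs-* q t)))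

        -- The quotient by `Q′`, taken on absolute values; for a solution it is exact on `X`.
        reduce : (Vec Bool n → ℤ) → Vec Bool n → ℤ
        reduce c x = sign (c x) ◃ (∣ c x ∣ / Q′)

        reduce-≡ : ∀ c → Solution c → ∀ {x} → x ∈ X → + Q′ * reduce c x ≡ c x
        reduce-≡ c sol {x} x∈ = begin
          + Q′ * (sign (c x) ◃ (∣ c x ∣ / Q′))     ≡⟨ *-comm (+ Q′) _ ⟩
          (sign (c x) ◃ (∣ c x ∣ / Q′)) * + Q′     ≡⟨ cong ((sign (c x) ◃ (∣ c x ∣ / Q′)) *_) (sym (+◃n≡+n Q′)) ⟩
          (sign (c x) ◃ (∣ c x ∣ / Q′)) * (Sign.+ ◃ Q′)
            ≡⟨ sym (◃-distrib-* (sign (c x)) Sign.+ (∣ c x ∣ / Q′) Q′) ⟩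
          (sign (c x) Sign.* Sign.+) ◃ (∣ c x ∣ / Q′ ℕ.* Q′)
            ≡⟨ cong₂ _◃_ (Signₚ.*-identityʳ (sign (c x))) (m/n*n≡m (Q′∣c c sol x∈)) ⟩
          sign (c x) ◃ ∣ c x ∣                     ≡⟨ signᵢ◃∣i∣≡i (c x) ⟩
          c x                                      ∎
          where open ≡-Reasoning

        reduce-solution : ∀ c → Solution c → Solution (reduce c)
        reduce-solution c sol i j = i*j≡0⇒j≡0 (+ Q′) (λ eq → ℕ.≢-nonZero⁻¹ Q′ (+-injective eq)) (begin
          + Q′ * ∑ X (λ x → reduce c x * (bit x i * bit x j))
            ≡⟨ sym (∑-*ˡ X (+ Q′) _) ⟩
          ∑ X (λ x → + Q′ * (reduce c x * (bit x i * bit x j)))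
            ≡⟨ ∑-cong-∈ X (λ {x} x∈ → trans (sym (*-assoc (+ Q′) (reduce c x) (bit x i * bit x j)))
                 (cong (_* (bit x i * bit x j)) (reduce-≡ c sol x∈))) ⟩
          ∑ X (λ x → c x * (bit x i * bit x j))
            ≡⟨ sol i j ⟩
          0ℤ ∎)
          where open ≡-Reasoning

        -- Infinite descent as an induction on a bound for the absolute value: the quotient by `Q′`
        -- is again a solution and has a smaller bound, because `Q′` is at least 2.
        trivial : ∀ N c → Solution c → ∀ {y} → y ∈ X → ∣ c y ∣ ℕ.≤ N → c y ≡ 0ℤ
        trivial zero    c sol y∈ le = ∣i∣≡0⇒i≡0 (ℕₚ.n≤0⇒n≡0 le)
        trivial (suc N) c sol {y} y∈ le = trans (sym (reduce-≡ c sol y∈))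
          (trans (cong (+ Q′ *_) (trivial N (reduce c) (reduce-solution c sol) y∈ (bound ∣ reduce c y ∣
            (subst (ℕ._≤ suc N) (trans (cong ∣_∣ (sym (reduce-≡ c sol y∈))) (abs-* (+ Q′) (reduce c y))) le))))
            (*-zeroʳ (+ Q′)))
          where
          bound : ∀ m → Q′ ℕ.* m ℕ.≤ suc N → m ℕ.≤ N
          bound zero    _ = z≤n
          bound (suc m) Qm≤ = ℕ.s≤s⁻¹ (ℕₚ.<-≤-trans
            (ℕₚ.<-≤-trans (ℕₚ.m<m*n (suc m) 2 ℕₚ.≤-refl) (ℕₚ.≤-trans (ℕₚ.*-monoʳ-≤ (suc m) Q′>1) (ℕₚ.≤-reflexive (ℕₚ.*-comm (suc m) Q′)))) Qm≤)

    module _ (w>0 : 0 ℕ.< w) {d e f : ℕ} (e≢d : e ≢ d) (f≢d : f ≢ d)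
             (dist : ∀ {x y} → x ∈ X → y ∈ X → x ≢ y → τ x y ≡ d ⊎ τ x y ≡ e ⊎ τ x y ≡ f) where

      private
        p q : ℤ
        p = + e * + f
        q = (+ e - + d) * (+ f - + d)

        K : ℕ → ℤ
        K t = (+ e - + t) * (+ f - + t)

        indicator : ℕ → ℤ
        indicator t = if t ℕ.≡ᵇ d then 1ℤ else 0ℤ

        indicator-no : ∀ {t} → t ≢ d → indicator t ≡ 0ℤ
        indicator-no {t} t≢d with t ℕ.≡ᵇ d | ℕₚ.≡ᵇ⇒≡ t d
        ... | true  | eq = contradiction (eq _) t≢d
        ... | false | _  = refl

        indicator-yes : indicator d ≡ 1ℤ
        indicator-yes with d ℕ.≡ᵇ d | ℕₚ.≡⇒≡ᵇ d d refl
        ... | true | _ = refl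

        -- `K` has the roots `e` and `f` and takes the value `q` at `d`.
        K-multiple : ∀ {t} → t ≡ d ⊎ t ≡ e ⊎ t ≡ f → K t ≡ q * indicator t
        K-multiple (inj₁ refl)        = sym (trans (cong (q *_) indicator-yes) (*-identityʳ q))
        K-multiple (inj₂ (inj₁ refl)) = trans (cong (_* (+ f - + e)) (+-inverseʳ (+ e)))
          (sym (trans (cong (q *_) (indicator-no e≢d)) (*-zeroʳ q)))
        K-multiple (inj₂ (inj₂ refl)) = trans (trans (cong ((+ e - + f) *_) (+-inverseʳ (+ f))) (*-zeroʳ (+ e - + f)))
          (sym (trans (cong (q *_) (indicator-no f≢d)) (*-zeroʳ q)))

        K-vanish : ∀ c → Solution c → ∀ {y} → y ∈ X → ∑ X (λ x → c x * K (τ x y)) ≡ 0ℤ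
        K-vanish c sol y∈ = i*j≡0⇒j≡0 (+ w * + w) (i≢0∧j≢0⇒i*j≢0 (+ w) (+ w) w≢0 w≢0) (quadratic c sol e f y∈)
          where
          w≢0 : + w ≢ 0ℤ
          w≢0 eq = ℕₚ.<⇒≢ w>0 (sym (+-injective eq))

        K0≡p : K 0 ≡ p
        K0≡p = cong₂ _*_ (+-identityʳ (+ e)) (+-identityʳ (+ f))

        q≢0 : ∣ q ∣ ≢ 0
        q≢0 eq = i≢0∧j≢0⇒i*j≢0 (+ e - + d) (+ f - + d)
          (λ z → e≢d (+-injective (i-j≡0⇒i≡j (+ e) (+ d) z))) (λ z → f≢d (+-injective (i-j≡0⇒i≡j (+ f) (+ d) z))) (∣i∣≡0⇒i≡0 eq)

      -- With more words than square-free monomials of degree 1 or 2 some solution is nonzero on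
      -- `X`. But `K` summed against a solution vanishes, so `q` divides `c y * p` throughout, and
      -- the descent forces the solution to be zero there.
      larman-rogers-seidel : ¬ (∣ q ∣ ∣ ∣ p ∣) → length X ℕ.≤ n ℕ.+ n C 2
      larman-rogers-seidel q∤p with length X ℕₚ.≤? n ℕ.+ n C 2
      ... | yes le = le
      ... | no nle with cofactor ∣ p ∣ ∣ q ∣ q≢0 q∤p
      ... | Q′ , Q′>1 , Q′∣ with null-vector (Vecₚ.≡-dec Boolₚ._≟_) uX equations (subst (ℕ._< length X) (sym length-equations) (ℕₚ.≰⇒> nle))
        where
        singles = map (λ i x → bit x i) L
        doubles = map (λ (i , j) x → bit x i * bit x j) (pairs n)
        equations : List (Vec Bool n → ℤ)
        equations = singles ++ doubles
        length-equations : length equations ≡ n ℕ.+ n C 2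
        length-equations = trans (length-++ singles) (cong₂ ℕ._+_ (trans (length-map _ L) (length-allFin n))
          (trans (length-map _ (pairs n)) (length-pairs n)))
      ... | c , (v , v∈ , cv≢0) , sols with ++⁻ (map (λ i x → bit x i) L) sols
      ...   | sols₁ , sols₂ = contradiction (Descent.trivial p q (λ c sol y∈ → divisible p q K indicator K0≡p (λ x∈ y∈ x≢y → K-multiple (dist x∈ y∈ x≢y)) c y∈ (K-vanish c sol y∈)) Q′>1 Q′∣ ∣ c v ∣ c solution v∈ ℕₚ.≤-refl) cv≢0
        where
        solution< : ∀ {i j} → i Fin.< j → ∑ X (λ x → c x * (bit x i * bit x j)) ≡ 0ℤ
        solution< i<j = All.lookup (map⁻ sols₂) (∈-pairs i<j)
        idem : ∀ b → ⟦ b ⟧ * ⟦ b ⟧ ≡ ⟦ b ⟧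
        idem true  = refl
        idem false = refl
        solution : Solution c
        solution i j with Finₚ.<-cmp i j
        ... | tri< i<j _ _  = solution< i<j
        ... | tri≈ _ refl _ = trans (∑-cong X (λ x → cong (c x *_) (idem (lookup x i)))) (All.lookup (map⁻ sols₁) (∈-allFin i))
        ... | tri> _ _ j<i  = trans (∑-cong X (λ x → cong (c x *_) (*-comm (bit x i) (bit x j)))) (solution< j<i)

  -- Weightings whose triple moments are lifted from pairs

  triples : ∀ n → List (Fin n × Fin n × Fin n)
  triples zero    = []
  triples (suc n) = map (λ (j , k) → zero , suc j , suc k) (pairs n) ++ map (λ (i , j , k) → suc i , suc j , suc k) (triples n)

  length-triples : ∀ n → length (triples n) ≡ n C 3
  length-triples zero    = refl
  length-triples (suc n) = begin
    length (triples (suc n))  ≡⟨ length-++ (map (λ (j , k) → zero , suc j , suc k) (pairs n)) ⟩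
    length (map (λ (j , k) → zero , suc j , suc k) (pairs n)) ℕ.+ length (map (λ (i , j , k) → suc i , suc j , suc k) (triples n))
      ≡⟨ cong₂ ℕ._+_ (trans (length-map _ (pairs n)) (length-pairs n)) (trans (length-map _ (triples n)) (length-triples n)) ⟩
    n C 2 ℕ.+ n C 3           ≡⟨ nCk+nC[k+1]≡[n+1]C[k+1] n 2 ⟩
    suc n C 3                 ∎
    where open ≡-Reasoning

  ∈-triples : ∀ {i j k : Fin n} → i Fin.< j → j Fin.< k → (i , j , k) ∈ triples n
  ∈-triples {suc n} {zero}  {suc j} {suc k} _         (s≤s j<k) = ∈-++⁺ˡ (∈-map⁺ _ (∈-pairs j<k))
  ∈-triples {suc n} {suc i} {suc j} {suc k} (s≤s i<j) (s≤s j<k) =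
    ∈-++⁺ʳ (map (λ (j , k) → zero , suc j , suc k) (pairs n)) (∈-map⁺ _ (∈-triples i<j j<k))

  pairs-< : ∀ {n} {i j : Fin n} → (i , j) ∈ pairs n → i Fin.< j
  pairs-< {suc n} p∈ with ∈-++⁻ (map (λ j → zero , suc j) (allFin n)) p∈
  ... | inj₁ p∈ˡ with ∈-map⁻ _ p∈ˡ
  ...   | _ , _ , refl = s≤s z≤n
  pairs-< {suc n} p∈ | inj₂ p∈ʳ with ∈-map⁻ _ p∈ʳ
  ...   | _ , q∈ , refl = s≤s (pairs-< q∈)

  pairs-unique : ∀ n → Unique (pairs n)
  pairs-unique zero    = []
  pairs-unique (suc n) = Uniqueₚ.++⁺ (Uniqueₚ.map⁺ (λ { refl → refl }) (Uniqueₚ.allFin⁺ n))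
    (Uniqueₚ.map⁺ (λ { refl → refl }) (pairs-unique n)) disjoint
    where
    disjoint : ∀ {p} → p ∈ map (λ j → zero , suc j) (allFin n) × p ∈ map (λ (i , j) → suc i , suc j) (pairs n) → ⊥
    disjoint (p∈ , q∈) with ∈-map⁻ _ p∈ | ∈-map⁻ _ q∈
    ... | _ , _ , refl | _ , _ , ()

  Unique-resp-↭ : ∀ {xs ys : List A} → xs ↭ ys → Unique xs → Unique ys
  Unique-resp-↭ xs↭ys = Permutationₛ.Unique-resp-↭ (setoid _) (↭⇒↭ₛ xs↭ys)

  ∑-sub : ∀ (xs : List A) (f g : A → ℤ) → ∑ xs (λ x → f x - g x) ≡ ∑ xs f - ∑ xs g
  ∑-sub []       f g = refl
  ∑-sub (x ∷ xs) f g = trans (cong (_+_ (f x - g x)) (∑-sub xs f g)) (interchange (f x) (g x) _ _)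
    where
    interchange : ∀ a b c d → a - b + (c - d) ≡ a + c - (b + d)
    interchange = solve-∀

  ∑-pos : ∀ {xs : List A} {f x} → (∀ x → 0ℤ ≤ f x) → x ∈ xs → 0ℤ < f x → 0ℤ < ∑ xs f
  ∑-pos {xs = x ∷ xs} f≥0 (here refl) fx>0 = +-mono-<-≤ fx>0 (∑-≥0 xs f≥0)
  ∑-pos {xs = x ∷ xs} f≥0 (there x∈)  fx>0 = +-mono-≤-< (f≥0 x) (∑-pos f≥0 x∈ fx>0)

  square-pos : ∀ i → i ≢ 0ℤ → 0ℤ < i * i
  square-pos (+ zero)  i≢0 = contradiction refl i≢0
  square-pos (+ suc m) i≢0 = +<+ (s≤s z≤n)
  square-pos -[1+ m ]  i≢0 = +<+ (s≤s z≤n)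

  _≟ₚ_ : DecidableEquality (Fin n × Fin n)
  _≟ₚ_ = Productₚ.≡-dec Finₚ._≟_ Finₚ._≟_

  module TripleSystem (X : List (Vec Bool n)) (uX : Unique X) where

    private
      L = allFin n

    Variable : Set
    Variable = Vec Bool n ⊎ (Fin n × Fin n)

    variables : List Variable
    variables = map inj₁ X ++ map inj₂ (pairs n)

    variables-unique : Unique variables
    variables-unique = Uniqueₚ.++⁺ (Uniqueₚ.map⁺ (λ { refl → refl }) uX) (Uniqueₚ.map⁺ (λ { refl → refl }) (pairs-unique n)) disjoint
      where
      disjoint : ∀ {p} → p ∈ map inj₁ X × p ∈ map inj₂ (pairs n) → ⊥
      disjoint (p∈ , q∈) with ∈-map⁻ _ p∈ | ∈-map⁻ _ q∈
      ... | _ , _ , refl | _ , _ , ()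

    length-variables : length variables ≡ length X ℕ.+ n C 2
    length-variables = trans (length-++ (map inj₁ X)) (cong₂ ℕ._+_ (length-map inj₁ X) (trans (length-map inj₂ (pairs n)) (length-pairs n)))

    δ : Fin n × Fin n → Fin n × Fin n → ℤ
    δ p r = if does (p ≟ₚ r) then 1ℤ else 0ℤ

    single-equation : Fin n → Variable → ℤ
    single-equation i (inj₁ x) = bit x i
    single-equation i (inj₂ _) = 0ℤ

    -- The equation says that the moment of `c` at i, j, k is the sum of `g` over the three pairs
    -- inside the triple.
    triple-equation : Fin n × Fin n × Fin n → Variable → ℤ
    triple-equation (i , j , k) (inj₁ x) = bit x i * (bit x j * bit x k)
    triple-equation (i , j , k) (inj₂ p) = - (δ (i , j) p + δ (i , k) p + δ (j , k) p)

    equations : List (Variable → ℤ)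
    equations = map single-equation L ++ map triple-equation (triples n)

    length-equations : length equations ≡ n ℕ.+ n C 3
    length-equations = trans (length-++ (map single-equation L)) (cong₂ ℕ._+_ (trans (length-map _ L) (length-allFin n))
      (trans (length-map _ (triples n)) (length-triples n)))

    module Solved (c̃ : Variable → ℤ) (sols : All (λ e → ∑ variables (λ v → c̃ v * e v) ≡ 0ℤ) equations) where

      c : Vec Bool n → ℤ
      c x = c̃ (inj₁ x)

      g : Fin n × Fin n → ℤ
      g p = c̃ (inj₂ p)

      private
        split : ∀ (e : Variable → ℤ) → ∑ variables (λ v → c̃ v * e v) ≡ ∑ X (λ x → c x * e (inj₁ x)) + ∑ (pairs n) (λ p → g p * e (inj₂ p))
        split e = trans (∑-++ (map inj₁ X) (map inj₂ (pairs n)) (λ v → c̃ v * e v))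
          (cong₂ _+_ (∑-map inj₁ X (λ v → c̃ v * e v)) (∑-map inj₂ (pairs n) (λ v → c̃ v * e v)))

        ∑-δ : ∀ {i j} → i Fin.< j → ∑ (pairs n) (λ p → g p * δ (i , j) p) ≡ g (i , j)
        ∑-δ {i} {j} i<j = trans (∑-single (pairs-unique n) (∈-pairs i<j) (λ {p} _ r≢p →
            trans (cong (λ b → g p * (if b then 1ℤ else 0ℤ)) (dec-false ((i , j) ≟ₚ p) r≢p)) (*-zeroʳ (g p))))
          (trans (cong (λ b → g (i , j) * (if b then 1ℤ else 0ℤ)) (dec-true ((i , j) ≟ₚ (i , j)) refl)) (*-identityʳ (g (i , j))))

      first-moment : ∀ i → ∑ X (λ x → c x * bit x i) ≡ 0ℤ
      first-moment i = begin
        ∑ X (λ x → c x * bit x i)        ≡⟨ sym (+-identityʳ _) ⟩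
        ∑ X (λ x → c x * bit x i) + 0ℤ   ≡⟨ cong (_+_ (∑ X (λ x → c x * bit x i))) (sym (∑-vanish (pairs n) (λ {p} _ → *-zeroʳ (g p)))) ⟩
        _                                ≡⟨ sym (split (single-equation i)) ⟩
        _                                ≡⟨ All.lookup (map⁻ (proj₁ (++⁻ (map single-equation L) sols))) (∈-allFin i) ⟩
        0ℤ                               ∎
        where open ≡-Reasoning

      u : (i j k : Fin n) → ℤ
      u i j k = ∑ X (λ x → c x * (bit x i * (bit x j * bit x k)))

      -- The symmetric form of `g`, whose equations mention increasing pairs only.
      h : (i j : Fin n) → ℤ
      h i j = if does (i Fin.<? j) then g (i , j) else g (j , i)

      private
        h-< : ∀ {i j} → i Fin.< j → h i j ≡ g (i , j)
        h-< {i} {j} i<j = cong (λ b → if b then g (i , j) else g (j , i)) (dec-true (i Fin.<? j) i<j)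

        h-≮ : ∀ {i j} → ¬ (i Fin.< j) → h i j ≡ g (j , i)
        h-≮ {i} {j} i≮j = cong (λ b → if b then g (i , j) else g (j , i)) (dec-false (i Fin.<? j) i≮j)

        h-sym : ∀ i j → h i j ≡ h j i
        h-sym i j with Finₚ.<-cmp i j
        ... | tri< i<j _ j≮i  = trans (h-< i<j) (sym (h-≮ j≮i))
        ... | tri≈ _ refl _   = refl
        ... | tri> i≮j _ j<i  = trans (h-≮ i≮j) (sym (h-< j<i))

        Lifted : (i j k : Fin n) → Set
        Lifted i j k = u i j k ≡ h i j + h i k + h j k

        sorted : ∀ {i j k} → i Fin.< j → j Fin.< k → Lifted i j k
        sorted {i} {j} {k} i<j j<k = begin
          u i j k                                     ≡⟨ cancel (u i j k) (g (i , j)) (g (i , k)) (g (j , k)) ⟩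
          (u i j k + - (g (i , j) + g (i , k) + g (j , k))) + (g (i , j) + g (i , k) + g (j , k))
            ≡⟨ cong (λ z → z + (g (i , j) + g (i , k) + g (j , k))) (trans (cong (_+_ (u i j k)) (sym right)) equation) ⟩
          0ℤ + (g (i , j) + g (i , k) + g (j , k))    ≡⟨ +-identityˡ _ ⟩
          g (i , j) + g (i , k) + g (j , k)           ≡⟨ sym (cong₂ _+_ (cong₂ _+_ (h-< i<j) (h-< (Finₚ.<-trans i<j j<k))) (h-< j<k)) ⟩
          h i j + h i k + h j k                       ∎
          where
          open ≡-Reasoning
          cancel : ∀ u a b c → u ≡ (u + - (a + b + c)) + (a + b + c)
          cancel = solve-∀
          distribute : ∀ g a b c → g * - (a + b + c) ≡ - 1ℤ * (g * a + g * b + g * c)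
          distribute = solve-∀
          negate : ∀ a → - 1ℤ * a ≡ - a
          negate = solve-∀
          right : ∑ (pairs n) (λ p → g p * triple-equation (i , j , k) (inj₂ p)) ≡ - (g (i , j) + g (i , k) + g (j , k))
          right = begin
            ∑ (pairs n) (λ p → g p * - (δ (i , j) p + δ (i , k) p + δ (j , k) p))
              ≡⟨ ∑-cong (pairs n) (λ p → distribute (g p) (δ (i , j) p) (δ (i , k) p) (δ (j , k) p)) ⟩
            ∑ (pairs n) (λ p → - 1ℤ * (g p * δ (i , j) p + g p * δ (i , k) p + g p * δ (j , k) p))
              ≡⟨ ∑-*ˡ (pairs n) (- 1ℤ) (λ p → g p * δ (i , j) p + g p * δ (i , k) p + g p * δ (j , k) p) ⟩
            - 1ℤ * ∑ (pairs n) (λ p → g p * δ (i , j) p + g p * δ (i , k) p + g p * δ (j , k) p)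
              ≡⟨ negate _ ⟩
            - ∑ (pairs n) (λ p → g p * δ (i , j) p + g p * δ (i , k) p + g p * δ (j , k) p)
              ≡⟨ cong -_ (trans (∑-+ (pairs n) (λ p → g p * δ (i , j) p + g p * δ (i , k) p) (λ p → g p * δ (j , k) p))
                   (cong₂ _+_ (trans (∑-+ (pairs n) (λ p → g p * δ (i , j) p) (λ p → g p * δ (i , k) p))
                     (cong₂ _+_ (∑-δ i<j) (∑-δ (Finₚ.<-trans i<j j<k)))) (∑-δ j<k))) ⟩
            - (g (i , j) + g (i , k) + g (j , k)) ∎
          equation : u i j k + ∑ (pairs n) (λ p → g p * triple-equation (i , j , k) (inj₂ p)) ≡ 0ℤ
          equation = trans (sym (split (triple-equation (i , j , k))))
            (All.lookup (map⁻ (proj₂ (++⁻ (map single-equation L) sols))) (∈-triples i<j j<k))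

        swapˡ : ∀ {i j k} → Lifted j i k → Lifted i j k
        swapˡ {i} {j} {k} eq = begin
          u i j k               ≡⟨ ∑-cong X (λ x → cong (c x *_) (exchange (bit x i) (bit x j) (bit x k))) ⟩
          u j i k               ≡⟨ eq ⟩
          h j i + h j k + h i k ≡⟨ cong (λ z → z + h j k + h i k) (h-sym j i) ⟩
          h i j + h j k + h i k ≡⟨ reorder (h i j) (h j k) (h i k) ⟩
          h i j + h i k + h j k ∎
          where
          open ≡-Reasoning
          exchange : ∀ a b c → a * (b * c) ≡ b * (a * c)
          exchange = solve-∀
          reorder : ∀ a b c → a + b + c ≡ a + c + b
          reorder = solve-∀

        swapʳ : ∀ {i j k} → Lifted i k j → Lifted i j k
        swapʳ {i} {j} {k} eq = begin
          u i j k               ≡⟨ ∑-cong X (λ x → cong (λ z → c x * (bit x i * z)) (*-comm (bit x j) (bit x k))) ⟩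
          u i k j               ≡⟨ eq ⟩
          h i k + h i j + h k j ≡⟨ cong₂ _+_ (+-comm (h i k) (h i j)) (h-sym k j) ⟩
          h i j + h i k + h j k ∎
          where open ≡-Reasoning

      -- Both sides are symmetric in the indices, so adjacent transpositions reduce every order to
      -- the increasing one.
      lifted : ∀ {i j k} → i ≢ j → i ≢ k → j ≢ k → u i j k ≡ h i j + h i k + h j k
      lifted {i} {j} {k} i≢j i≢k j≢k = cases (Finₚ.<-cmp i j) (Finₚ.<-cmp j k) (Finₚ.<-cmp i k)
        where
        cases : _ → _ → _ → Lifted i j k
        cases (tri≈ _ i≡j _) _ _ = contradiction i≡j i≢j
        cases _ (tri≈ _ j≡k _) _ = contradiction j≡k j≢k
        cases _ _ (tri≈ _ i≡k _) = contradiction i≡k i≢k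
        cases (tri< i<j _ _) (tri< j<k _ _) _ = sorted i<j j<k
        cases (tri< i<j _ _) (tri> _ _ k<j) (tri< i<k _ _) = swapʳ (sorted i<k k<j)
        cases (tri< i<j _ _) (tri> _ _ k<j) (tri> _ _ k<i) = swapʳ (swapˡ (sorted k<i i<j))
        cases (tri> _ _ j<i) (tri< j<k _ _) (tri< i<k _ _) = swapˡ (sorted j<i i<k)
        cases (tri> _ _ j<i) (tri< j<k _ _) (tri> _ _ k<i) = swapˡ (swapʳ (sorted j<k k<i))
        cases (tri> _ _ j<i) (tri> _ _ k<j) _ = swapˡ (swapʳ (swapˡ (sorted k<j j<i)))

      -- The moment is differenced in each of its three indices, while each summand of its lifted
      -- form depends on two of them only and so cancels.
      third-moment : ∀ {a b i j k l M} → L ↭ a ∷ b ∷ i ∷ j ∷ k ∷ l ∷ M →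
        ∑ X (λ x → c x * (bit x a - bit x b) * (bit x i - bit x j) * (bit x k - bit x l)) ≡ 0ℤ
      third-moment {a} {b} {i} {j} {k} {l} L↭ with Unique-resp-↭ L↭ (Uniqueₚ.allFin⁺ n)
      ... | (a≢b ∷ a≢i ∷ a≢j ∷ a≢k ∷ a≢l ∷ _) ∷ (b≢i ∷ b≢j ∷ b≢k ∷ b≢l ∷ _) ∷ (i≢j ∷ i≢k ∷ i≢l ∷ _) ∷ (j≢k ∷ j≢l ∷ _) ∷ _ = begin
        ∑ X (λ x → c x * (bit x a - bit x b) * (bit x i - bit x j) * (bit x k - bit x l))
          ≡⟨ ∑-cong X (λ x → expand (c x) (bit x a) (bit x b) (bit x i) (bit x j) (bit x k) (bit x l)) ⟩
        ∑ X (λ x → ((t a i k x - t a i l x) - (t a j k x - t a j l x)) - ((t b i k x - t b i l x) - (t b j k x - t b j l x)))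
          ≡⟨ trans (∑-sub X _ _) (cong₂ _-_
               (trans (∑-sub X _ _) (cong₂ _-_ (∑-sub X _ _) (∑-sub X _ _)))
               (trans (∑-sub X _ _) (cong₂ _-_ (∑-sub X _ _) (∑-sub X _ _)))) ⟩
        ((u a i k - u a i l) - (u a j k - u a j l)) - ((u b i k - u b i l) - (u b j k - u b j l))
          ≡⟨ cong₂ _-_ (cong₂ _-_ (cong₂ _-_ (lifted a≢i a≢k i≢k) (lifted a≢i a≢l i≢l)) (cong₂ _-_ (lifted a≢j a≢k j≢k) (lifted a≢j a≢l j≢l)))
                       (cong₂ _-_ (cong₂ _-_ (lifted b≢i b≢k i≢k) (lifted b≢i b≢l i≢l)) (cong₂ _-_ (lifted b≢j b≢k j≢k) (lifted b≢j b≢l j≢l))) ⟩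
        _ ≡⟨ cancel (h a i) (h a j) (h b i) (h b j) (h a k) (h a l) (h b k) (h b l) (h i k) (h i l) (h j k) (h j l) ⟩
        0ℤ ∎
        where
        open ≡-Reasoning
        t : (i j k : Fin n) → Vec Bool n → ℤ
        t i j k x = c x * (bit x i * (bit x j * bit x k))
        expand : ∀ c a b i j k l → c * (a - b) * (i - j) * (k - l) ≡
          ((c * (a * (i * k)) - c * (a * (i * l))) - (c * (a * (j * k)) - c * (a * (j * l)))) -
          ((c * (b * (i * k)) - c * (b * (i * l))) - (c * (b * (j * k)) - c * (b * (j * l))))
        expand = solve-∀
        cancel : ∀ ai aj bi bj ak al bk bl ik il jk jl →
          (((ai + ak + ik) - (ai + al + il)) - ((aj + ak + jk) - (aj + al + jl))) -
          (((bi + bk + ik) - (bi + bl + il)) - ((bj + bk + jk) - (bj + bl + jl))) ≡ 0ℤ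
        cancel = solve-∀

      -- The inclusion map from functions on pairs to functions on triples is injective from five
      -- points on: the sums over the ten triples of a five-point set determine the value at each
      -- pair.
      lifting-injective : (∀ {x} → x ∈ X → c x ≡ 0ℤ) → 5 ℕ.≤ n → ∀ {p} → p ∈ pairs n → g p ≡ 0ℤ
      lifting-injective c≡0 n≥5 {a , b} p∈ = trans (sym (h-< a<b)) (i*j≡0⇒j≡0 (+ 6) (λ ()) (six (others)))
        where
        a<b : a Fin.< b
        a<b = pairs-< p∈
        b≢a : b ≢ a
        b≢a b≡a = Finₚ.<-irrefl (sym b≡a) a<b
        Others : Set
        Others = ∃ λ k → ∃ λ l → ∃ λ m → ∃ λ M → L ↭ a ∷ b ∷ k ∷ l ∷ m ∷ M
        others : Others
        others with ∈⇒↭ (∈-allFin a)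
        ... | L₁ , L↭ with ∈-resp-↭ L↭ (∈-allFin b)
        ...   | here b≡a = contradiction b≡a b≢a
        ...   | there b∈ with ∈⇒↭ b∈
        ...     | L₂ , L₁↭ = choose L₂ (↭-trans L↭ (prep a L₁↭)) (subst (5 ℕ.≤_) (trans (sym (length-allFin n)) (↭-length (↭-trans L↭ (prep a L₁↭)))) n≥5)
          where
          choose : ∀ L₂ → L ↭ a ∷ b ∷ L₂ → 5 ℕ.≤ 2 ℕ.+ length L₂ → Others
          choose (k ∷ l ∷ m ∷ M) p _ = k , l , m , M , p
          choose []              _ (s≤s (s≤s ()))
          choose (_ ∷ [])        _ (s≤s (s≤s (s≤s ())))
          choose (_ ∷ _ ∷ [])    _ (s≤s (s≤s (s≤s (s≤s ()))))
        u≡0 : ∀ i j k → u i j k ≡ 0ℤ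
        u≡0 i j k = ∑-vanish X (λ {x} x∈ → trans (cong (_* (bit x i * (bit x j * bit x k))) (c≡0 x∈)) (*-zeroˡ (bit x i * (bit x j * bit x k))))
        zero-sum : ∀ {i j k} → i ≢ j → i ≢ k → j ≢ k → h i j + h i k + h j k ≡ 0ℤ
        zero-sum {i} {j} {k} i≢j i≢k j≢k = trans (sym (lifted i≢j i≢k j≢k)) (u≡0 i j k)
        -- The first row equals 2 ab - 2 kl, and likewise for km and lm. Adding the three and twice
        -- the sum over the triple k, l, m leaves 6 ab.
        identity : ∀ ab ak al am bk bl bm kl km lm → + 6 * ab ≡
          (((ab + ak + bk) + (ab + al + bl)) - ((ak + al + kl) + (bk + bl + kl))) +
          (((ab + ak + bk) + (ab + am + bm)) - ((ak + am + km) + (bk + bm + km))) +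
          (((ab + al + bl) + (ab + am + bm)) - ((al + am + lm) + (bl + bm + lm))) +
          + 2 * (kl + km + lm)
        identity = solve-∀
        six : Others → + 6 * h a b ≡ 0ℤ
        six (k , l , m , M , L↭) with Unique-resp-↭ L↭ (Uniqueₚ.allFin⁺ n)
        ... | (a≢b ∷ a≢k ∷ a≢l ∷ a≢m ∷ _) ∷ (b≢k ∷ b≢l ∷ b≢m ∷ _) ∷ (k≢l ∷ k≢m ∷ _) ∷ (l≢m ∷ _) ∷ _ =
          trans (identity (h a b) (h a k) (h a l) (h a m) (h b k) (h b l) (h b m) (h k l) (h k m) (h l m))
            (cong₂ _+_ (cong₂ _+_ (cong₂ _+_
              (cong₂ _-_ (cong₂ _+_ (zero-sum a≢b a≢k b≢k) (zero-sum a≢b a≢l b≢l)) (cong₂ _+_ (zero-sum a≢k a≢l k≢l) (zero-sum b≢k b≢l k≢l)))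
              (cong₂ _-_ (cong₂ _+_ (zero-sum a≢b a≢k b≢k) (zero-sum a≢b a≢m b≢m)) (cong₂ _+_ (zero-sum a≢k a≢m k≢m) (zero-sum b≢k b≢m k≢m))))
              (cong₂ _-_ (cong₂ _+_ (zero-sum a≢b a≢l b≢l) (zero-sum a≢b a≢m b≢m)) (cong₂ _+_ (zero-sum a≢l a≢m l≢m) (zero-sum b≢l b≢m l≢m))))
              (cong (+ 2 *_) (zero-sum k≢l k≢m l≢m)))

  -- The bound from vanishing energies of degrees 0, 1 and 3

  module _ {w : ℕ} {X : List (Vec Bool n)} (wX : All (λ x → weight x ≡ w) X) (uX : Unique X) where

    private
      L = allFin n

      -- Every word has `w` ones, so the singleton moments add up to `w` times the sum of `c`.
      zeroth-energy : ∀ c → 0 ℕ.< w → (∀ i → ∑ X (λ x → c x * bit x i) ≡ 0ℤ) → energy X 0 L c ≡ 0ℤ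
      zeroth-energy c w>0 m₁ = cong₂ _*_ ∑c≡0 ∑c≡0
        where
        open ≡-Reasoning
        ∑c≡0 : ∑ X c ≡ 0ℤ
        ∑c≡0 = i*j≡0⇒j≡0 (+ w) (λ eq → ℕₚ.<⇒≢ w>0 (sym (+-injective eq))) (begin
          + w * ∑ X c                          ≡⟨ sym (∑-*ˡ X (+ w) c) ⟩
          ∑ X (λ x → + w * c x)                ≡⟨ ∑-cong-∈ X (λ {x} x∈ → trans (*-comm (+ w) (c x)) (cong (c x *_)
                                                    (trans (cong +_ (sym (All.lookup wX x∈))) (weight-∑ x)))) ⟩
          ∑ X (λ x → c x * ∑ L (bit x))        ≡⟨ ∑-cong X (λ x → sym (∑-*ˡ L (c x) (bit x))) ⟩
          ∑ X (λ x → ∑ L (λ i → c x * bit x i)) ≡⟨ ∑-swap X L (λ x i → c x * bit x i) ⟩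
          ∑ L (λ i → ∑ X (λ x → c x * bit x i)) ≡⟨ ∑-vanish L (λ {i} _ → m₁ i) ⟩
          0ℤ                                   ∎)

      first-energy : ∀ c → (∀ i → ∑ X (λ x → c x * bit x i) ≡ 0ℤ) → energy X 1 L c ≡ 0ℤ
      first-energy c m₁ = ∑-vanish (picks L) (λ {(i , L′)} _ → ∑-vanish (picks L′) (λ {(j , _)} _ → cong₂ _*_ (difference i j) (difference i j)))
        where
        difference : ∀ i j → ∑ X (λ x → c x * (bit x i - bit x j)) ≡ 0ℤ
        difference i j = trans (∑-cong X (λ x → *-distribˡ-− (c x) (bit x i) (bit x j)))
          (trans (∑-sub X _ _) (cong₂ _-_ (m₁ i) (m₁ j)))
          where
          *-distribˡ-− : ∀ c a b → c * (a - b) ≡ c * a - c * b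
          *-distribˡ-− = solve-∀

      third-energy : ∀ c → (∀ {a b i j k l M} → L ↭ a ∷ b ∷ i ∷ j ∷ k ∷ l ∷ M →
        ∑ X (λ x → c x * (bit x a - bit x b) * (bit x i - bit x j) * (bit x k - bit x l)) ≡ 0ℤ) → energy X 3 L c ≡ 0ℤ
      third-energy c m₃ =
        ∑-vanish (picks L)  λ {(a , L₁)} a∈ → ∑-vanish (picks L₁) λ {(b , L₂)} b∈ →
        ∑-vanish (picks L₂) λ {(i , L₃)} i∈ → ∑-vanish (picks L₃) λ {(j , L₄)} j∈ →
        ∑-vanish (picks L₄) λ {(k , L₅)} k∈ → ∑-vanish (picks L₅) λ {(l , L₆)} l∈ →
        let L↭ = ↭-trans (picks-↭ L a∈) (prep a (↭-trans (picks-↭ L₁ b∈) (prep b (↭-trans (picks-↭ L₂ i∈) (prep i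
                   (↭-trans (picks-↭ L₃ j∈) (prep j (↭-trans (picks-↭ L₄ k∈) (prep k (picks-↭ L₅ l∈))))))))))
        in cong₂ _*_ (m₃ L↭) (m₃ L↭)

    private
      -- The unknowns on pairs account for the term `n C 2` subtracted in the bound.
      enough : n C 3 ℕ.∸ n C 2 ℕ.+ n ℕ.< length X → length (TripleSystem.equations X uX) ℕ.< length (TripleSystem.variables X uX)
      enough lt = begin-strict
        length (TripleSystem.equations X uX)       ≡⟨ TripleSystem.length-equations X uX ⟩
        -- An inequality suffices here and is valid for truncated subtraction whichever coefficient
        -- is larger.
        n ℕ.+ n C 3                                ≤⟨ ℕₚ.+-monoʳ-≤ n (ℕₚ.m≤n+m∸n (n C 3) (n C 2)) ⟩
        n ℕ.+ (n C 2 ℕ.+ (n C 3 ℕ.∸ n C 2))        ≡⟨ rearrange n (n C 2) (n C 3 ℕ.∸ n C 2) ⟩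
        n C 3 ℕ.∸ n C 2 ℕ.+ n ℕ.+ n C 2            <⟨ ℕₚ.+-monoˡ-< (n C 2) lt ⟩
        length X ℕ.+ n C 2                         ≡⟨ sym (TripleSystem.length-variables X uX) ⟩
        length (TripleSystem.variables X uX)       ∎
        where
        open ℕₚ.≤-Reasoning
        rearrange : ∀ a b c → a ℕ.+ (b ℕ.+ c) ≡ c ℕ.+ a ℕ.+ b
        rearrange = ℕ-solve-∀

      -- The nonzero unknown may belong to a pair; but if `c` vanished on all words, then
      -- `lifting-injective` would make the pair unknowns vanish too.
      nonzero : ∀ c̃ sols → 5 ℕ.≤ n → ∀ {v} → v ∈ TripleSystem.variables X uX → c̃ v ≢ 0ℤ →
                ∃ λ x → x ∈ X × TripleSystem.Solved.c X uX c̃ sols x ≢ 0ℤ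
      nonzero c̃ sols n≥5 v∈ c̃v≢0 with any? (λ x → ¬? (c̃ (inj₁ x) ≟ 0ℤ)) X
      ... | yes some = find some
      ... | no none with ∈-++⁻ (map inj₁ X) v∈
      ...   | inj₁ v∈ˡ with ∈-map⁻ inj₁ v∈ˡ
      ...     | x , x∈ , refl = x , x∈ , c̃v≢0
      nonzero c̃ sols n≥5 v∈ c̃v≢0 | no none | inj₂ v∈ʳ with ∈-map⁻ inj₂ v∈ʳ
      ...     | p , p∈ , refl = contradiction (TripleSystem.Solved.lifting-injective X uX c̃ sols
                  (λ {x} x∈ → decidable-stable (c̃ (inj₁ x) ≟ 0ℤ) (All.lookup (¬Any⇒All¬ X none) x∈)) n≥5 p∈) c̃v≢0

      vanishing-energies : 0 ℕ.< w → 5 ℕ.≤ n → n C 3 ℕ.∸ n C 2 ℕ.+ n ℕ.< length X →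
        Σ (Vec Bool n → ℤ) λ c → (∃ λ x → x ∈ X × c x ≢ 0ℤ) × energy X 0 L c ≡ 0ℤ × energy X 1 L c ≡ 0ℤ × energy X 3 L c ≡ 0ℤ
      vanishing-energies w>0 n≥5 lt =
        let c̃ , (_ , v∈ , c̃v≢0) , sols = null-vector (Sumₚ.≡-dec (Vecₚ.≡-dec Boolₚ._≟_) _≟ₚ_)
              (TripleSystem.variables-unique X uX) (TripleSystem.equations X uX) (enough lt)
            open TripleSystem.Solved X uX c̃ sols
        in c , nonzero c̃ sols n≥5 v∈ c̃v≢0 , zeroth-energy c w>0 first-moment , first-energy c first-moment , third-energy c third-moment

    -- On a weighting from `vanishing-energies` the form of `F` retains only its term of degree 2,
    -- which is nonpositive, whereas `energy-annihilator` makes it a positive multiple of a sum of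
    -- squares that is not zero.
    harmonic-bound : 0 ℕ.< w → 5 ℕ.≤ n → ∀ f₀ f₁ f₂ f₃ → let F = expansion (1 , 2 , 3) (f₀ , f₁ , f₂ , f₃) in
      (∀ {x y} → x ∈ X → y ∈ X → x ≢ y → value n w F (τ x y) ≡ 0ℤ) → f₂ ≤ 0ℤ → 0ℤ < value n w F 0 →
      length X ℕ.≤ n C 3 ℕ.∸ n C 2 ℕ.+ n
    harmonic-bound w>0 n≥5 f₀ f₁ f₂ f₃ F≡0 f₂≤0 F0>0 = ℕₚ.≮⇒≥ (λ lt → absurd (vanishing-energies w>0 n≥5 lt))
      where
      F : Expansion
      F = expansion (1 , 2 , 3) (f₀ , f₁ , f₂ , f₃)
      absurd : ¬ (Σ (Vec Bool n → ℤ) λ c → (∃ λ x → x ∈ X × c x ≢ 0ℤ) ×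
                  energy X 0 L c ≡ 0ℤ × energy X 1 L c ≡ 0ℤ × energy X 3 L c ≡ 0ℤ)
      absurd (c , (x₀ , x₀∈ , cx₀≢0) , E₀≡0 , E₁≡0 , E₃≡0) = <-irrefl equal (≤-<-trans nonpositive strictly-positive)
        where
        E : ℕ → ℤ
        E k = energy X k L c
        total S : ℤ
        total = ∑ F (λ (f , k) → f * E k)
        S = ∑ X (λ x → c x * c x)
        vanish : ∀ f {z} → z ≡ 0ℤ → f * z ≡ 0ℤ
        vanish f z≡0 = trans (cong (f *_) z≡0) (*-zeroʳ f)
        drop-zeros : ∀ a → 0ℤ + (0ℤ + (a + (0ℤ + 0ℤ))) ≡ a
        drop-zeros = solve-∀
        total≡ : total ≡ f₂ * E 2
        total≡ = trans (cong₂ _+_ (vanish f₀ E₀≡0) (cong₂ _+_ (vanish f₁ E₁≡0)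
          (cong (λ z → f₂ * E 2 + (z + 0ℤ)) (vanish f₃ E₃≡0)))) (drop-zeros (f₂ * E 2))
        nonpositive : total ≤ 0ℤ
        nonpositive = subst (_≤ 0ℤ) (sym total≡) (subst (f₂ * E 2 ≤_) (*-zeroˡ (E 2))
          (*-monoʳ-≤-nonNeg (E 2) {{nonNegative (energy-≥0 X 2 L c)}} f₂≤0))
        S>0 : 0ℤ < S
        S>0 = ∑-pos (λ x → square-≥0 (c x)) x₀∈ (square-pos (c x₀) cx₀≢0)
        strictly-positive : 0ℤ < S * value n w F 0
        strictly-positive = subst (_< S * value n w F 0) (*-zeroˡ (value n w F 0))
          (*-monoʳ-<-pos (value n w F 0) {{positive F0>0}} S>0)
        equal : total ≡ S * value n w F 0
        equal = energy-annihilator wX F c uX F≡0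

  -- The certificates

  Row : Set
  Row = ℤ × ℤ × ℤ

  -- The factor `1ℤ` and the final `0ℤ` give it the very form to which `value` of an `expansion`
  -- unfolds.
  evaluate : Coefficients → Row → ℤ
  evaluate (f₀ , f₁ , f₂ , f₃) (r₁ , r₂ , r₃) = f₀ * 1ℤ + (f₁ * r₁ + (f₂ * r₂ + (f₃ * r₃ + 0ℤ)))

  determinant : (a b c d e f g h i : ℤ) → ℤ
  determinant a b c d e f g h i = a * (e * i - f * h) - b * (d * i - f * g) + c * (d * h - e * g)

  -- The coefficients f with f₀ + f₁ r₁ + f₂ r₂ + f₃ r₃ = 0 on three rows, by Cramer's rule.
  minors : Row → Row → Row → Coefficients
  minors (a , b , c) (d , e , f) (g , h , i) =
    determinant a b c d e f g h i ,
    - determinant 1ℤ b c 1ℤ e f 1ℤ h i ,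
    determinant 1ℤ a c 1ℤ d f 1ℤ g i ,
    - determinant 1ℤ a b 1ℤ d e 1ℤ g h

  -- Cramer's rule fixes the coefficients up to sign only; applied with the value at distance 0,
  -- this makes that value nonnegative.
  orient : ℤ → Coefficients → Coefficients
  orient (+ _)     f                     = f
  orient -[1+ _ ]  (f₀ , f₁ , f₂ , f₃)   = - f₀ , - f₁ , - f₂ , - f₃

  isZero isNonNeg isNonPos isPos : ℤ → Bool
  isZero (+ zero)     = true
  isZero _            = false
  isNonNeg (+ _)      = true
  isNonNeg -[1+ _ ]   = false
  isNonPos (+ suc _)  = false
  isNonPos _          = true
  isPos (+ suc _)     = true
  isPos _             = false

  annihilates : Row → Row → Row → Coefficients → Bool
  annihilates R₁ R₂ R₃ f = isZero (evaluate f R₁) ∧ isZero (evaluate f R₂) ∧ isZero (evaluate f R₃)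

  -- The hypotheses of `linear-programming-bound` with `T = t`, where `F₀` is the value at distance
  -- 0.
  lp-test : ℕ → ℤ → Coefficients → Bool
  lp-test t F₀ (f₀ , f₁ , f₂ , f₃) =
    isNonNeg f₁ ∧ isNonNeg f₂ ∧ isNonNeg f₃ ∧ isPos f₀ ∧ isPos (f₀ * + suc t - F₀)

  harmonic-test : ℤ → Coefficients → Bool
  harmonic-test F₀ (f₀ , f₁ , f₂ , f₃) = isNonPos f₂ ∧ isPos F₀

  module Certificate (test : ℤ → Coefficients → Bool) (R₀ R₁ R₂ R₃ : Row) where

    -- The three zeros are recomputed for the concrete coefficients, which takes the place of a
    -- proof of Cramer's rule.
    verified oriented : Coefficients → Bool
    verified f = test (evaluate f R₀) f ∧ annihilates R₁ R₂ R₃ f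
    oriented f = verified (orient (evaluate f R₀) f)

    certificate : Bool
    certificate = oriented (minors R₁ R₂ R₃)

  -- The values S k d of the spherical functions are a parameter so that they can be read from a shared table.
  module _ (S : ℕ → ℕ → ℤ) (D : Triple) where

    row : Triple → ℕ → Row
    row (k₁ , k₂ , k₃) d = S k₁ d , S k₂ d , S k₃ d

    -- Opaque, since conversion checking would otherwise expand the determinants symbolically.
    opaque
      certificate-at : (ℤ → Coefficients → Bool) → Triple → Bool
      certificate-at test ks = Certificate.certificate test (row ks 0) (row ks (proj₁ D)) (row ks (proj₁ (proj₂ D))) (row ks (proj₂ (proj₂ D)))

    lp-search : ℕ → List Triple → Bool
    lp-search t = any (certificate-at (lp-test t))

    harmonic-search : Bool
    harmonic-search = certificate-at harmonic-test (1 , 2 , 3)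

  -- The degrees k₁ < k₂ < k₃ to be tried, found by a greedy search so that every case is covered.
  candidates : List (ℕ × ℕ × ℕ)
  candidates =
    (1 , 2 , 3) ∷ (2 , 3 , 4) ∷ (1 , 4 , 5) ∷ (3 , 4 , 5) ∷ (3 , 5 , 6) ∷ (1 , 3 , 4) ∷ (4 , 5 , 6) ∷
    (5 , 6 , 7) ∷ (1 , 2 , 4) ∷ (3 , 4 , 6) ∷ (2 , 4 , 5) ∷ (1 , 7 , 8) ∷ (2 , 3 , 5) ∷ (3 , 5 , 7) ∷
    (4 , 5 , 8) ∷ (6 , 7 , 8) ∷ (4 , 6 , 7) ∷ (2 , 4 , 6) ∷ (4 , 5 , 7) ∷ (1 , 3 , 5) ∷ (2 , 5 , 7) ∷
    (1 , 8 , 9) ∷ (2 , 5 , 6) ∷ (1 , 2 , 9) ∷ (4 , 7 , 8) ∷ (3 , 4 , 7) ∷ (2 , 3 , 7) ∷ (1 , 2 , 8) ∷ []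

  bound₁ : ℕ → ℕ
  bound₁ n = n C 3 ℕ.∸ n C 2 ℕ.+ n
  bound₂ : ℕ → ℕ → ℕ
  bound₂ n w = (n ℕ.∸ w ℕ.+ 3) C 3

  test₁ test₂ : (ℕ → ℕ → ℤ) → (w n : ℕ) → Triple → Bool
  test₁ S w n D = harmonic-search S D ∨ lp-search S D (bound₁ n) candidates
  test₂ S w n D = lp-search S D (bound₂ n w) candidates

  lookupOr : ∀ {A : Set} → A → List A → ℕ → A
  lookupOr a []       i       = a
  lookupOr a (x ∷ xs) zero    = x
  lookupOr a (x ∷ xs) (suc i) = lookupOr a xs i

  -- Degrees 0 to 9 contain those of all candidates, and distances 0 to 22 suffice for lengths up to
  -- 45 with `2 * w ≤ n` and for weights up to 8.
  table : (n w : ℕ) → List (List ℤ)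
  table n w = applyUpTo (λ k → applyUpTo (johnson n w k) 23) 10

  -- With the function itself as default, agreement with `johnson` holds for all degrees and
  -- distances, inside the table or not.
  entry : (n w : ℕ) → List (List ℤ) → ℕ → ℕ → ℤ
  entry n w tab k d = lookupOr (johnson n w k d) (lookupOr [] tab k) d

  lrs-test : (d e f : ℕ) → Bool
  lrs-test d e f = not (isYes (∣ (+ e - + d) * (+ f - + d) ∣ ∣? ∣ + e * + f ∣))

  -- The increasing triples that integrality leaves open: the divisibility holds whichever of the
  -- three distances is singled out.
  exceptional : Triple → Bool
  exceptional (d₁ , d₂ , d₃) = (d₁ ℕ.<ᵇ d₂) ∧ (d₂ ℕ.<ᵇ d₃) ∧
    not (lrs-test d₁ d₂ d₃ ∨ lrs-test d₂ d₁ d₃ ∨ lrs-test d₃ d₁ d₂)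

  range : ℕ → ℕ → List ℕ
  range lo hi = applyUpTo (lo ℕ.+_) (suc hi ℕ.∸ lo)

  exceptional-triples : ℕ → List Triple
  exceptional-triples m = filter (λ D → T? (exceptional D))
    (cartesianProduct (range 1 m) (cartesianProduct (range 1 m) (range 1 m)))

  module _ (test : (ℕ → ℕ → ℤ) → (w n : ℕ) → Triple → Bool) where

    -- Triples with a distance above `w` pass at once, as no two words of weight `w` are that far
    -- apart.
    check-triple : (ℕ → ℕ → ℤ) → (w n : ℕ) → Triple → Bool
    check-triple S w n D = (w ℕ.<ᵇ proj₂ (proj₂ D)) ∨ test S w n D

    check-triples : (w n : ℕ) → List (List ℤ) → List Triple → Bool
    check-triples w n tab = all (check-triple (entry n w tab) w n)

    check-range : (lower : ℕ → ℕ) (upper : ℕ) → List ℕ → List Triple → Bool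
    check-range lower upper ws Ds = all (λ w → all (λ n → check-triples w n (table n w) Ds) (range (lower w) upper)) ws

  -- For each weight, the length from which the respective claim covers it; the last clause of
  -- `lower₂` provides for weight 8.
  lower₁ lower₂ : ℕ → ℕ
  lower₁ w = 11 ℕ.⊔ (2 ℕ.* w)
  lower₂ 4 = 11
  lower₂ 5 = 13
  lower₂ 6 = 16
  lower₂ 7 = 20
  lower₂ _ = 25

  -- Soundness of the Boolean tests

  ∧-elim : ∀ {a b} → T (a ∧ b) → T a × T b
  ∧-elim = to T-∧

  ∨-elim : ∀ {a b} → T (a ∨ b) → T a ⊎ T b
  ∨-elim = to T-∨

  isZero-sound : ∀ i → T (isZero i) → i ≡ 0ℤ
  isZero-sound (+ zero) _ = refl

  isNonNeg-sound : ∀ i → T (isNonNeg i) → 0ℤ ≤ i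
  isNonNeg-sound (+ _) _ = +≤+ z≤n

  isNonPos-sound : ∀ i → T (isNonPos i) → i ≤ 0ℤ
  isNonPos-sound (+ zero) _ = ≤-refl
  isNonPos-sound -[1+ _ ] _ = -≤+

  isPos-sound : ∀ i → T (isPos i) → 0ℤ < i
  isPos-sound (+ suc _) _ = +<+ (s≤s z≤n)

  module _ {test : ℤ → Coefficients → Bool} {R₀ R₁ R₂ R₃ : Row} where
    open Certificate test R₀ R₁ R₂ R₃

    Verified : Set
    Verified = ∃ λ f → T (test (evaluate f R₀) f) × evaluate f R₁ ≡ 0ℤ × evaluate f R₂ ≡ 0ℤ × evaluate f R₃ ≡ 0ℤ

    verified-sound : ∀ f → T (verified f) → Verified
    verified-sound f ok =
      let ok₀ , ok₁₂₃ = ∧-elim {test (evaluate f R₀) f} ok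
          ok₁ , ok₂₃  = ∧-elim {isZero (evaluate f R₁)} ok₁₂₃
          ok₂ , ok₃   = ∧-elim {isZero (evaluate f R₂)} ok₂₃
      in f , ok₀ , isZero-sound (evaluate f R₁) ok₁ , isZero-sound (evaluate f R₂) ok₂ , isZero-sound (evaluate f R₃) ok₃

    oriented-sound : ∀ f → T (oriented f) → Verified
    oriented-sound f = verified-sound (orient (evaluate f R₀) f)

    certificate-sound : T certificate → Verified
    certificate-sound = oriented-sound (minors R₁ R₂ R₃)

  module _ {n w : ℕ} {X : List (Vec Bool n)} (wX : All (λ x → weight x ≡ w) X) (uX : Unique X)
           {d₁ d₂ d₃ : ℕ} (dist : ∀ {x y} → x ∈ X → y ∈ X → x ≢ y → τ x y ≡ d₁ ⊎ τ x y ≡ d₂ ⊎ τ x y ≡ d₃)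
           (S : ℕ → ℕ → ℤ) (S≡ : ∀ k d → S k d ≡ johnson n w k d) where

    private
      D : Triple
      D = d₁ , d₂ , d₃

      evaluate-value : ∀ ks f d → evaluate f (row S D ks d) ≡ value n w (expansion ks f) d
      evaluate-value (k₁ , k₂ , k₃) f d rewrite S≡ k₁ d | S≡ k₂ d | S≡ k₃ d = refl

      annihilator : ∀ F → value n w F d₁ ≡ 0ℤ → value n w F d₂ ≡ 0ℤ → value n w F d₃ ≡ 0ℤ →
                    ∀ {x y} → x ∈ X → y ∈ X → x ≢ y → value n w F (τ x y) ≡ 0ℤ
      annihilator F z₁ z₂ z₃ x∈ y∈ x≢y = [ at z₁ , [ at z₂ , at z₃ ]′ ]′ (dist x∈ y∈ x≢y)
        where
        at : ∀ {d t} → value n w F d ≡ 0ℤ → t ≡ d → value n w F t ≡ 0ℤ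
        at z refl = z

      Witness : (ℤ → Coefficients → Bool) → Triple → Set
      Witness test ks = ∃ λ f → T (test (value n w (expansion ks f) 0) f) ×
        (∀ {x y} → x ∈ X → y ∈ X → x ≢ y → value n w (expansion ks f) (τ x y) ≡ 0ℤ)

      opaque
        unfolding certificate-at

        witness : ∀ test ks → T (certificate-at S D test ks) → Witness test ks
        witness test ks ok =
          let f , ok₀ , z₁ , z₂ , z₃ = certificate-sound {test} {row S D ks 0} {row S D ks d₁} {row S D ks d₂} {row S D ks d₃} ok
          in f , subst (λ v → T (test v f)) (evaluate-value ks f 0) ok₀ ,
             annihilator (expansion ks f) (trans (sym (evaluate-value ks f d₁)) z₁)
               (trans (sym (evaluate-value ks f d₂)) z₂) (trans (sym (evaluate-value ks f d₃)) z₃)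

      lp-witness : ∀ t ks → Witness (lp-test t) ks → length X ℕ.≤ t
      lp-witness t (k₁ , k₂ , k₃) ((+ suc f₀ , f₁ , f₂ , f₃) , ok , zero-on-D) =
        let ok₁ , ok′   = ∧-elim ok
            ok₂ , ok″   = ∧-elim ok′
            ok₃ , ok‴   = ∧-elim ok″
            F = (+ suc f₀ , 0) ∷ (f₁ , k₁) ∷ (f₂ , k₂) ∷ (f₃ , k₃) ∷ []
        in linear-programming-bound wX uX f₀ ((f₁ , k₁) ∷ (f₂ , k₂) ∷ (f₃ , k₃) ∷ []) t
             (isNonNeg-sound f₁ ok₁ ∷ isNonNeg-sound f₂ ok₂ ∷ isNonNeg-sound f₃ ok₃ ∷ []) zero-on-D
             (0<j-i⇒i<j (value n w F 0) (+ suc f₀ * + suc t) (isPos-sound _ ok‴))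
        where
        0<j-i⇒i<j : ∀ i j → 0ℤ < j - i → i < j
        0<j-i⇒i<j i j 0<j-i = subst₂ _<_ (+-identityˡ i) (lemma i j) (+-monoˡ-< i 0<j-i)
          where
          lemma : ∀ i j → j - i + i ≡ j
          lemma = solve-∀
      lp-witness t ks ((+ zero , f₁ , f₂ , f₃) , ok , _) =
        let _ , ok′ = ∧-elim {isNonNeg f₁} ok
            _ , ok″ = ∧-elim {isNonNeg f₂} ok′
            _ , ok‴ = ∧-elim {isNonNeg f₃} ok″
        in contradiction ok‴ (λ ())
      lp-witness t ks ((-[1+ _ ] , f₁ , f₂ , f₃) , ok , _) =
        let _ , ok′ = ∧-elim {isNonNeg f₁} ok
            _ , ok″ = ∧-elim {isNonNeg f₂} ok′
            _ , ok‴ = ∧-elim {isNonNeg f₃} ok″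
        in contradiction ok‴ (λ ())

    lp-search-sound : ∀ t kss → T (lp-search S D t kss) → length X ℕ.≤ t
    lp-search-sound t kss ok =
      let ks , ok′ = satisfied (any⁻ (certificate-at S D (lp-test t)) kss ok)
      in lp-witness t ks (witness (lp-test t) ks ok′)

    harmonic-search-sound : 0 ℕ.< w → 5 ℕ.≤ n → T (harmonic-search S D) → length X ℕ.≤ bound₁ n
    harmonic-search-sound w>0 n≥5 ok = bound (witness harmonic-test (1 , 2 , 3) ok)
      where
      bound : Witness harmonic-test (1 , 2 , 3) → length X ℕ.≤ bound₁ n
      bound ((f₀ , f₁ , f₂ , f₃) , ok₀ , zero-on-D) =
        let F₀ = value n w (expansion (1 , 2 , 3) (f₀ , f₁ , f₂ , f₃)) 0
            f₂≤0 , F₀>0 = ∧-elim {isNonPos f₂} {isPos F₀} ok₀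
        in harmonic-bound wX uX w>0 n≥5 f₀ f₁ f₂ f₃ zero-on-D (isNonPos-sound f₂ f₂≤0) (isPos-sound F₀ F₀>0)

  lookupOr-applyUpTo : ∀ {A : Set} (f : ℕ → A) m i → lookupOr (f i) (applyUpTo f m) i ≡ f i
  lookupOr-applyUpTo f zero    i       = refl
  lookupOr-applyUpTo f (suc m) zero    = refl
  lookupOr-applyUpTo f (suc m) (suc i) = lookupOr-applyUpTo (λ j → f (suc j)) m i

  lookupOr-applyUpTo² : ∀ {A : Set} (f : ℕ → ℕ → A) l m i j →
    lookupOr (f i j) (lookupOr [] (applyUpTo (λ i → applyUpTo (f i) m) l) i) j ≡ f i j
  lookupOr-applyUpTo² f zero    m i       j = refl
  lookupOr-applyUpTo² f (suc l) m zero    j = lookupOr-applyUpTo (f 0) m j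
  lookupOr-applyUpTo² f (suc l) m (suc i) j = lookupOr-applyUpTo² (λ k → f (suc k)) l m i j

  entry-table : ∀ n w k d → entry n w (table n w) k d ≡ johnson n w k d
  entry-table n w = lookupOr-applyUpTo² (johnson n w) 10 23

  ∈-range : ∀ {lo hi i} → lo ℕ.≤ i → i ℕ.≤ hi → i ∈ range lo hi
  ∈-range {lo} {hi} {i} lo≤i i≤hi = subst (_∈ range lo hi) (ℕₚ.m+[n∸m]≡n lo≤i)
    (∈-applyUpTo⁺ (lo ℕ.+_) (ℕₚ.∸-monoˡ-< (s≤s i≤hi) lo≤i))

  lrs-test-sound : ∀ d e f → T (lrs-test d e f) → ¬ (∣ (+ e - + d) * (+ f - + d) ∣ ∣ ∣ + e * + f ∣)
  lrs-test-sound d e f ok with ∣ (+ e - + d) * (+ f - + d) ∣ ∣? ∣ + e * + f ∣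
  ... | no ∤ = ∤

  module _ {n w : ℕ} {X : List (Vec Bool n)} (wX : All (λ x → weight x ≡ w) X) (uX : Unique X) (w>0 : 0 ℕ.< w)
           {d₁ d₂ d₃ : ℕ} (d₁<d₂ : d₁ ℕ.< d₂) (d₂<d₃ : d₂ ℕ.< d₃)
           (dist : ∀ {x y} → x ∈ X → y ∈ X → x ≢ y → τ x y ≡ d₁ ⊎ τ x y ≡ d₂ ⊎ τ x y ≡ d₃) where

    -- Each of the three distances can take the role of `d` in `larman-rogers-seidel`, after a
    -- permutation of the alternatives in `dist`.
    lrs-or-exceptional : length X ℕ.≤ n ℕ.+ n C 2 ⊎ T (exceptional (d₁ , d₂ , d₃))
    lrs-or-exceptional = decide (T? lrs)
      where
      lrs = lrs-test d₁ d₂ d₃ ∨ lrs-test d₂ d₁ d₃ ∨ lrs-test d₃ d₁ d₂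
      d₁<d₃ = ℕₚ.<-trans d₁<d₂ d₂<d₃
      swap₁₂ : ∀ {A B C : Set} → A ⊎ B ⊎ C → B ⊎ A ⊎ C
      swap₁₂ = [ (λ a → inj₂ (inj₁ a)) , [ inj₁ , (λ c → inj₂ (inj₂ c)) ]′ ]′
      rotate : ∀ {A B C : Set} → A ⊎ B ⊎ C → C ⊎ A ⊎ B
      rotate = [ (λ a → inj₂ (inj₁ a)) , [ (λ b → inj₂ (inj₂ b)) , inj₁ ]′ ]′
      decide : _ → _
      decide (no ¬lrs) = inj₂ (from T-∧ (ℕₚ.<⇒<ᵇ d₁<d₂ , from T-∧ (ℕₚ.<⇒<ᵇ d₂<d₃ , T-not lrs ¬lrs)))
        where
        open Equivalence using (from)
        T-not : ∀ b → ¬ T b → T (not b)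
        T-not true  ¬t = contradiction tt ¬t
        T-not false _  = tt
      decide (yes ok) = inj₁ ([ case₁ , (λ ok′ → [ case₂ , case₃ ]′ (∨-elim {lrs-test d₂ d₁ d₃} ok′)) ]′ (∨-elim {lrs-test d₁ d₂ d₃} ok))
        where
        case₁ : T (lrs-test d₁ d₂ d₃) → length X ℕ.≤ n ℕ.+ n C 2
        case₁ t = larman-rogers-seidel wX uX w>0 (ℕₚ.>⇒≢ d₁<d₂) (ℕₚ.>⇒≢ d₁<d₃) dist (lrs-test-sound d₁ d₂ d₃ t)
        case₂ : T (lrs-test d₂ d₁ d₃) → length X ℕ.≤ n ℕ.+ n C 2
        case₂ t = larman-rogers-seidel wX uX w>0 (ℕₚ.<⇒≢ d₁<d₂) (ℕₚ.>⇒≢ d₂<d₃)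
          (λ x∈ y∈ x≢y → swap₁₂ (dist x∈ y∈ x≢y)) (lrs-test-sound d₂ d₁ d₃ t)
        case₃ : T (lrs-test d₃ d₁ d₂) → length X ℕ.≤ n ℕ.+ n C 2
        case₃ t = larman-rogers-seidel wX uX w>0 (ℕₚ.<⇒≢ d₁<d₃) (ℕₚ.<⇒≢ d₂<d₃)
          (λ x∈ y∈ x≢y → rotate (dist x∈ y∈ x≢y)) (lrs-test-sound d₃ d₁ d₂ t)

  -- The given weight, length and triple are members of the lists swept by the check, and `d₃ ≤ w`
  -- rules out the early exit of `check-triple`.
  check-range-sound : ∀ test lower upper {lo hi m} → check-range test lower upper (range lo hi) (exceptional-triples m) ≡ true →
    ∀ {w n d₁ d₂ d₃} → lo ℕ.≤ w → w ℕ.≤ hi → lower w ℕ.≤ n → n ℕ.≤ upper →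
    1 ℕ.≤ d₁ → d₁ ℕ.< d₂ → d₂ ℕ.< d₃ → d₃ ℕ.≤ w → d₃ ℕ.≤ m → T (exceptional (d₁ , d₂ , d₃)) →
    T (test (entry n w (table n w)) w n (d₁ , d₂ , d₃))
  check-range-sound test lower upper {lo} {hi} {m} ok {w} {n} {d₁} {d₂} {d₃} lo≤w w≤hi lower≤n n≤upper 1≤d₁ d₁<d₂ d₂<d₃ d₃≤w d₃≤m exc =
    [ (λ w<d₃ → contradiction (ℕₚ.<ᵇ⇒< w d₃ w<d₃) (ℕₚ.≤⇒≯ d₃≤w)) , (λ t → t) ]′ (∨-elim at-D)
    where
    at-w : T (all (λ n → check-triples test w n (table n w) (exceptional-triples m)) (range (lower w) upper))
    at-w = All.lookup (all⁺ _ (range lo hi) (subst T (sym ok) tt)) (∈-range lo≤w w≤hi)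
    at-n : T (check-triples test w n (table n w) (exceptional-triples m))
    at-n = All.lookup (all⁺ _ (range (lower w) upper) at-w) (∈-range lower≤n n≤upper)
    d₂≤m = ℕₚ.≤-trans (ℕₚ.<⇒≤ d₂<d₃) d₃≤m
    d₁≤m = ℕₚ.≤-trans (ℕₚ.<⇒≤ d₁<d₂) d₂≤m
    1≤d₂ = ℕₚ.≤-trans 1≤d₁ (ℕₚ.<⇒≤ d₁<d₂)
    1≤d₃ = ℕₚ.≤-trans 1≤d₂ (ℕₚ.<⇒≤ d₂<d₃)
    at-D : T (check-triple test (entry n w (table n w)) w n (d₁ , d₂ , d₃))
    at-D = All.lookup (all⁺ _ (exceptional-triples m) at-n)
      (∈-filter⁺ (λ D → T? (exceptional D)) (∈-cartesianProduct⁺ (∈-range 1≤d₁ d₁≤m)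
        (∈-cartesianProduct⁺ (∈-range 1≤d₂ d₂≤m) (∈-range 1≤d₃ d₃≤m))) exc)

  -- Sorting the three distances

  sort₃ : ∀ {H : ℕ → ℕ → ℕ → Set} {A : Set} →
    (∀ {a b c} → H a b c → H b a c) → (∀ {a b c} → H a b c → H a c b) →
    (∀ {a b c} → a ℕ.< b → b ℕ.< c → H a b c → A) →
    ∀ {a b c} → a ≢ b → a ≢ c → b ≢ c → H a b c → A
  sort₃ swapˡ swapʳ k {a} {b} {c} a≢b a≢c b≢c H with ℕₚ.<-cmp a b | ℕₚ.<-cmp b c | ℕₚ.<-cmp a c
  ... | tri≈ _ a≡b _ | _            | _            = contradiction a≡b a≢b
  ... | _            | tri≈ _ b≡c _ | _            = contradiction b≡c b≢c
  ... | _            | _            | tri≈ _ a≡c _ = contradiction a≡c a≢c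
  ... | tri< a<b _ _ | tri< b<c _ _ | _            = k a<b b<c H
  ... | tri< a<b _ _ | tri> _ _ c<b | tri< a<c _ _ = k a<c c<b (swapʳ H)
  ... | tri< a<b _ _ | tri> _ _ c<b | tri> _ _ c<a = k c<a a<b (swapˡ (swapʳ H))
  ... | tri> _ _ b<a | tri< b<c _ _ | tri< a<c _ _ = k b<a a<c (swapˡ H)
  ... | tri> _ _ b<a | tri< b<c _ _ | tri> _ _ c<a = k b<c c<a (swapʳ (swapˡ H))
  ... | tri> _ _ b<a | tri> _ _ c<b | _            = k c<b b<a (swapˡ (swapʳ (swapˡ H)))

  -- Each listed distance is attained by distinct words of weight `w`, so it lies between 1 and `w`.
  -- These bounds and the distance condition survive transpositions, so the triple may be taken
  -- increasing.
  three-distances : ∀ {n w} {X : List (Vec Bool n)} → IsSDistanceSet n w 3 X → ∀ {A : Set} →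
    (∀ {d₁ d₂ d₃} → 1 ℕ.≤ d₁ → d₁ ℕ.< d₂ → d₂ ℕ.< d₃ → d₃ ℕ.≤ w →
      (∀ {x y} → x ∈ X → y ∈ X → x ≢ y → τ x y ≡ d₁ ⊎ τ x y ≡ d₂ ⊎ τ x y ≡ d₃) → A) → A
  three-distances {n} {w} {X} (wX , uX , a ∷ b ∷ c ∷ [] , refl , ((a≢b ∷ a≢c ∷ []) ∷ (b≢c ∷ []) ∷ _) , dist , attained) {A} k =
    sort₃ {H = H} (λ (p , q , r , s) → q , p , r , λ x∈ y∈ x≢y → swapˡ (s x∈ y∈ x≢y))
      (λ (p , q , r , s) → p , r , q , λ x∈ y∈ x≢y → swapʳ (s x∈ y∈ x≢y))
      (λ a<b b<c ((1≤a , _) , _ , (_ , c≤w) , s) → k 1≤a a<b b<c c≤w s) a≢b a≢c b≢c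
      (bounds a (here refl) , bounds b (there (here refl)) , bounds c (there (there (here refl))) ,
       λ {x} {y} x∈ y∈ x≢y → cases (dist x y x∈ y∈ x≢y))
    where
    H : ℕ → ℕ → ℕ → Set
    H a b c = (1 ℕ.≤ a × a ℕ.≤ w) × (1 ℕ.≤ b × b ℕ.≤ w) × (1 ℕ.≤ c × c ℕ.≤ w) ×
              (∀ {x y} → x ∈ X → y ∈ X → x ≢ y → τ x y ≡ a ⊎ τ x y ≡ b ⊎ τ x y ≡ c)
    swapˡ : ∀ {A B C : Set} → A ⊎ B ⊎ C → B ⊎ A ⊎ C
    swapˡ = [ (λ a → inj₂ (inj₁ a)) , [ inj₁ , (λ c → inj₂ (inj₂ c)) ]′ ]′
    swapʳ : ∀ {A B C : Set} → A ⊎ B ⊎ C → A ⊎ C ⊎ B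
    swapʳ = [ inj₁ , [ (λ b → inj₂ (inj₂ b)) , (λ c → inj₂ (inj₁ c)) ]′ ]′
    cases : ∀ {t} → t ∈ a ∷ b ∷ c ∷ [] → t ≡ a ⊎ t ≡ b ⊎ t ≡ c
    cases (here eq)                 = inj₁ eq
    cases (there (here eq))         = inj₂ (inj₁ eq)
    cases (there (there (here eq))) = inj₂ (inj₂ eq)
    bounds : ∀ d → d ∈ a ∷ b ∷ c ∷ [] → 1 ℕ.≤ d × d ℕ.≤ w
    bounds d d∈ with attained d d∈
    ... | x , y , x∈ , y∈ , x≢y , refl =
      ℕₚ.n≢0⇒n>0 (λ eq → x≢y (τ≡0⇒≡ x y (All.lookup wX x∈) (All.lookup wX y∈) eq)) , τ≤w x y (All.lookup wX x∈) (All.lookup wX y∈)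

-- The extremal family and the theorem

open import Data.Nat using (_+_; _*_; _∸_; _≤_; _<_; _≤ᵇ_; ⌊_/2⌋)
open import Data.Integer using (ℤ)

module _ {n w : ℕ} {X : List (Vec Bool n)} (wX : All (λ x → weight x ≡ w) X) (uX : Unique X)
         {d₁ d₂ d₃ : ℕ} (dist : ∀ {x y} → x ∈ X → y ∈ X → x ≢ y → τ x y ≡ d₁ ⊎ τ x y ≡ d₂ ⊎ τ x y ≡ d₃)
         (S : ℕ → ℕ → ℤ) (S≡ : ∀ k d → S k d ≡ johnson n w k d) where

  test₁-sound : 0 < w → 5 ≤ n → T (test₁ S w n (d₁ , d₂ , d₃)) → length X ≤ bound₁ n
  test₁-sound w>0 n≥5 ok = [ harmonic-search-sound wX uX dist S S≡ w>0 n≥5 ,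
    lp-search-sound wX uX dist S S≡ (bound₁ n) candidates ]′ (∨-elim {harmonic-search S (d₁ , d₂ , d₃)} ok)

  test₂-sound : T (test₂ S w n (d₁ , d₂ , d₃)) → length X ≤ bound₂ n w
  test₂-sound = lp-search-sound wX uX dist S S≡ (bound₂ n w) candidates

-- The finite verification and the upper bounds

opaque
  unfolding certificate-at

  -- Proved by evaluation, for which `certificate-at` is unfolded in this block. Weight 22 is the
  -- largest with `2 * w ≤ 45`.
  check₁ : check-range test₁ lower₁ 45 (range 4 22) (exceptional-triples 22) ≡ true
  check₁ = refl

  check₂ : check-range test₂ lower₂ 50 (range 4 8) (exceptional-triples 8) ≡ true
  check₂ = refl

-- Evaluated length by length; it turns the bound from integrality into the one claimed.
lrs≤bound₁ : ∀ {n} → 11 ≤ n → n ≤ 45 → n + n C 2 ≤ bound₁ n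
lrs≤bound₁ {n} lo hi = ℕₚ.≤ᵇ⇒≤ (n + n C 2) (bound₁ n) (All.lookup (all⁺ (λ n → (n + n C 2) ≤ᵇ bound₁ n) (range 11 45) tt) (∈-range lo hi))

lrs≤bound₂ : ∀ {n w} → 4 ≤ w → w ≤ 8 → lower₂ w ≤ n → n ≤ 50 → n + n C 2 ≤ bound₂ n w
lrs≤bound₂ {n} {w} 4≤w w≤8 lo hi = ℕₚ.≤ᵇ⇒≤ (n + n C 2) (bound₂ n w) (All.lookup (all⁺ _ (range (lower₂ w) 50) at-w) (∈-range lo hi))
  where
  at-w : T (all (λ n → (n + n C 2) ≤ᵇ bound₂ n w) (range (lower₂ w) 50))
  at-w = All.lookup (all⁺ (λ w → all (λ n → (n + n C 2) ≤ᵇ bound₂ n w) (range (lower₂ w) 50)) (range 4 8) tt) (∈-range 4≤w w≤8)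

upper-bound₁ : ∀ n w → 11 ≤ n → n ≤ 45 → 4 ≤ w → 2 * w ≤ n → A≤ n w 3 (bound₁ n)
upper-bound₁ n w 11≤n n≤45 4≤w 2w≤n X X-3@(wX , uX , _) = three-distances X-3 λ 1≤d₁ d₁<d₂ d₂<d₃ d₃≤w dist →
  [ (λ le → ℕₚ.≤-trans le (lrs≤bound₁ 11≤n n≤45)) ,
    (λ exc → test₁-sound wX uX dist (entry n w (table n w)) (entry-table n w) w>0 (ℕₚ.≤-trans (ℕₚ.m≤m+n 5 6) 11≤n)
      (check-range-sound test₁ lower₁ 45 {4} {22} {22} check₁ 4≤w w≤22 (ℕₚ.⊔-lub 11≤n 2w≤n) n≤45
        1≤d₁ d₁<d₂ d₂<d₃ d₃≤w (ℕₚ.≤-trans d₃≤w w≤22) exc)) ]′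
  (lrs-or-exceptional wX uX w>0 d₁<d₂ d₂<d₃ dist)
  where
  w>0 : 0 < w
  w>0 = ℕₚ.≤-trans (s≤s z≤n) 4≤w
  -- Twice 23 is 46, beyond the largest length.
  w≤22 : w ≤ 22
  w≤22 = ℕₚ.≮⇒≥ (λ 23≤w → ℕₚ.<⇒≱ (ℕₚ.≤-trans (ℕₚ.*-monoʳ-≤ 2 23≤w) 2w≤n) n≤45)

upper-bound₂ : ∀ n w → 4 ≤ w → w ≤ 8 → lower₂ w ≤ n → n ≤ 50 → A≤ n w 3 (bound₂ n w)
upper-bound₂ n w 4≤w w≤8 lo n≤50 X X-3@(wX , uX , _) = three-distances X-3 λ 1≤d₁ d₁<d₂ d₂<d₃ d₃≤w dist →
  [ (λ le → ℕₚ.≤-trans le (lrs≤bound₂ 4≤w w≤8 lo n≤50)) ,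
    (λ exc → test₂-sound wX uX dist (entry n w (table n w)) (entry-table n w)
      (check-range-sound test₂ lower₂ 50 {4} {8} {8} check₂ 4≤w w≤8 lo n≤50
        1≤d₁ d₁<d₂ d₂<d₃ d₃≤w (ℕₚ.≤-trans d₃≤w w≤8) exc)) ]′
  (lrs-or-exceptional wX uX (ℕₚ.≤-trans (s≤s z≤n) 4≤w) d₁<d₂ d₂<d₃ dist)

-- Words of given weight and the star family

words : (k m : ℕ) → List (Vec Bool m)
words zero    m       = replicate m false ∷ []
words (suc k) zero    = []
words (suc k) (suc m) = map (true ∷_) (words k m) ++ map (false ∷_) (words (suc k) m)

-- The recursion of `words` on the first letter is Pascal's rule.
length-words : ∀ k m → length (words k m) ≡ m C k
length-words zero    m    = sym (trans (nCk≡nC[n∸k] {0} {m} z≤n) (nCn≡1 m))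
length-words (suc k) zero = sym (k>n⇒nCk≡0 {0} {suc k} (s≤s z≤n))
length-words (suc k) (suc m) = trans (length-++ (map (true ∷_) (words k m)))
  (trans (cong₂ _+_ (trans (length-map _ (words k m)) (length-words k m)) (trans (length-map _ (words (suc k) m)) (length-words (suc k) m)))
    (nCk+nC[k+1]≡[n+1]C[k+1] m k))

weight-false : ∀ m → weight (replicate m false) ≡ 0
weight-false zero    = refl
weight-false (suc m) = weight-false m

weight≡0 : ∀ {m} (v : Vec Bool m) → weight v ≡ 0 → v ≡ replicate m false
weight≡0 []          eq = refl
weight≡0 (false ∷ v) eq = cong (false ∷_) (weight≡0 v eq)

words-weight : ∀ k m {v} → v ∈ words k m → weight v ≡ k
words-weight zero m (here refl) = weight-false m
words-weight (suc k) (suc m) v∈ with ∈-++⁻ (map (true ∷_) (words k m)) v∈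
... | inj₁ v∈ˡ with ∈-map⁻ (true ∷_) v∈ˡ
...   | u , u∈ , refl = cong suc (words-weight k m u∈)
words-weight (suc k) (suc m) v∈ | inj₂ v∈ʳ with ∈-map⁻ (false ∷_) v∈ʳ
...   | u , u∈ , refl = words-weight (suc k) m u∈

∈-words : ∀ {k m} (v : Vec Bool m) → weight v ≡ k → v ∈ words k m
∈-words {zero} v eq = here (weight≡0 v eq)
∈-words {suc k} (true ∷ v)  eq = ∈-++⁺ˡ (∈-map⁺ (true ∷_) (∈-words v (ℕₚ.suc-injective eq)))
∈-words {suc k} {suc m} (false ∷ v) eq = ∈-++⁺ʳ (map (true ∷_) (words k m)) (∈-map⁺ (false ∷_) (∈-words v eq))

words-unique : ∀ k m → Unique (words k m)
words-unique zero    m       = [] ∷ []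
words-unique (suc k) zero    = []
words-unique (suc k) (suc m) = Uniqueₚ.++⁺ (Uniqueₚ.map⁺ Vecₚ.∷-injectiveʳ (words-unique k m))
  (Uniqueₚ.map⁺ Vecₚ.∷-injectiveʳ (words-unique (suc k) m)) disjoint
  where
  disjoint : ∀ {v} → v ∈ map (true ∷_) (words k m) × v ∈ map (false ∷_) (words (suc k) m) → ⊥
  disjoint (u∈ , v∈) with ∈-map⁻ (true ∷_) u∈ | ∈-map⁻ (false ∷_) v∈
  ... | _ , _ , refl | _ , _ , ()

ones++ : ∀ t {m} → Vec Bool m → Vec Bool (t + m)
ones++ t v = replicate t true Vec.++ v

weight-ones++ : ∀ t {m} (v : Vec Bool m) → weight (ones++ t v) ≡ t + weight v
weight-ones++ zero    v = refl
weight-ones++ (suc t) v = cong suc (weight-ones++ t v)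

hamming-ones++ : ∀ t {m} (u v : Vec Bool m) → hamming (ones++ t u) (ones++ t v) ≡ hamming u v
hamming-ones++ zero    u v = refl
hamming-ones++ (suc t) u v = hamming-ones++ t u v

τ-ones++ : ∀ t {m} (u v : Vec Bool m) → τ (ones++ t u) (ones++ t v) ≡ τ u v
τ-ones++ t u v = cong ⌊_/2⌋ (hamming-ones++ t u v)

ones++-injective : ∀ t {m} {u v : Vec Bool m} → ones++ t u ≡ ones++ t v → u ≡ v
ones++-injective t = Vecₚ.++-injectiveʳ (replicate t true) (replicate t true)

-- The extremal family, with `t` standing for w - 3 fixed ones and `m` for the n - w + 3 free
-- coordinates.
star : (t m : ℕ) → List (Vec Bool (t + m))
star t m = map (ones++ t) (words 3 m)

-- The fixed ones contribute nothing to distances, so these are the distances between 3-sets. Six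
-- free coordinates make room for two disjoint 3-sets, which attain distance 3.
star-3-distance : ∀ t r → IsSDistanceSet (t + (6 + r)) (t + 3) 3 (star t (6 + r))
star-3-distance t r =
  All.tabulate weights , Uniqueₚ.map⁺ (ones++-injective t) (words-unique 3 (6 + r)) ,
  1 ∷ 2 ∷ 3 ∷ [] , refl , (((λ ()) ∷ (λ ()) ∷ []) ∷ ((λ ()) ∷ []) ∷ [] ∷ []) , distances , attained
  where
  m = 6 + r
  weights : ∀ {x} → x ∈ star t m → weight x ≡ t + 3
  weights x∈ with ∈-map⁻ (ones++ t) x∈
  ... | u , u∈ , refl = trans (weight-ones++ t u) (cong (t +_) (words-weight 3 m u∈))
  small : ∀ d → 0 < d → d ≤ 3 → d ∈ 1 ∷ 2 ∷ 3 ∷ []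
  small 1 _ _ = here refl
  small 2 _ _ = there (here refl)
  small 3 _ _ = there (there (here refl))
  small (suc (suc (suc (suc _)))) _ (s≤s (s≤s (s≤s ())))
  distances : ∀ x y → x ∈ star t m → y ∈ star t m → x ≢ y → τ x y ∈ 1 ∷ 2 ∷ 3 ∷ []
  distances x y x∈ y∈ x≢y with ∈-map⁻ (ones++ t) x∈ | ∈-map⁻ (ones++ t) y∈
  ... | u , u∈ , refl | v , v∈ , refl = subst (_∈ 1 ∷ 2 ∷ 3 ∷ []) (sym (τ-ones++ t u v))
    (small (τ u v) (ℕₚ.n≢0⇒n>0 (λ eq → x≢y (cong (ones++ t) (τ≡0⇒≡ u v wu wv eq)))) (τ≤w u v wu wv))
    where
    wu = words-weight 3 m u∈
    wv = words-weight 3 m v∈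
  tail : Vec Bool r
  tail = replicate r false
  -- The word with index i differs from `v₀` by exchanging i ones, hence lies at distance i from it.
  v₀ v₁ v₂ v₃ : Vec Bool m
  v₀ = true ∷ true ∷ true ∷ false ∷ false ∷ false ∷ tail
  v₁ = true ∷ true ∷ false ∷ true ∷ false ∷ false ∷ tail
  v₂ = true ∷ false ∷ false ∷ true ∷ true ∷ false ∷ tail
  v₃ = false ∷ false ∷ false ∷ true ∷ true ∷ true ∷ tail
  member : ∀ v → weight v ≡ 3 → ones++ t v ∈ star t m
  member v eq = ∈-map⁺ (ones++ t) (∈-words v eq)
  weight-3 : 3 + weight tail ≡ 3
  weight-3 = cong (3 +_) (weight-false r)
  attains : ∀ {d} v → weight v ≡ 3 → v₀ ≢ v → τ v₀ v ≡ d →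
    ∃₂ λ x y → x ∈ star t m × y ∈ star t m × x ≢ y × τ x y ≡ d
  attains v wv v₀≢v eq = ones++ t v₀ , ones++ t v , member v₀ weight-3 , member v wv ,
    (λ eq → v₀≢v (ones++-injective t eq)) , trans (τ-ones++ t v₀ v) eq
  τ-tail : ∀ d → d + ⌊ hamming tail tail /2⌋ ≡ d
  τ-tail d = trans (cong (λ h → d + ⌊ h /2⌋) (hamming-refl tail)) (ℕₚ.+-identityʳ d)
  attained : ∀ d → d ∈ 1 ∷ 2 ∷ 3 ∷ [] → ∃₂ λ x y → x ∈ star t m × y ∈ star t m × x ≢ y × τ x y ≡ d
  attained _ (here refl)                 = attains v₁ weight-3 (λ ()) (τ-tail 1)
  attained _ (there (here refl))         = attains v₂ weight-3 (λ ()) (τ-tail 2)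
  attained _ (there (there (here refl))) = attains v₃ weight-3 (λ ()) (τ-tail 3)

-- The hypotheses give `w = 3 + t` and `n = w + 3 + r`, which leaves `6 + r` free coordinates for
-- the star.
lower-bound : ∀ n w → 3 ≤ w → w + 3 ≤ n → Σ (List (Vec Bool n)) λ X → IsSDistanceSet n w 3 X × length X ≡ bound₂ n w
lower-bound n w 3≤w w+3≤n with ℕₚ.m≤n⇒∃[o]m+o≡n 3≤w | ℕₚ.m≤n⇒∃[o]m+o≡n w+3≤n
... | t , refl | r , refl = subst₂ (λ n w → Σ (List (Vec Bool n)) λ X → IsSDistanceSet n w 3 X × length X ≡ bound₂ n w)
    (shuffle t r) (ℕₚ.+-comm t 3) (star t (6 + r) , star-3-distance t r , size)
  where
  shuffle : ∀ t r → t + (6 + r) ≡ 3 + t + 3 + r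
  shuffle = ℕ-solve-∀
  size : length (star t (6 + r)) ≡ (t + (6 + r) ∸ (t + 3) + 3) C 3
  size = trans (length-map (ones++ t) (words 3 (6 + r))) (trans (length-words 3 (6 + r))
    (cong (_C 3) (sym (trans (cong (_+ 3) (ℕₚ.[m+n]∸[m+o]≡n∸o t (6 + r) 3)) (ℕₚ.+-comm (3 + r) 3)))))

equality₂ : ∀ n w hi-w → 4 ≤ hi-w → hi-w ≤ 8 → lower₂ hi-w ≤ n → n ≤ 50 → 4 ≤ w → w ≤ hi-w → A≡ n w 3 (bound₂ n w)
equality₂ n w hi-w 4≤hi-w hi-w≤8 lo n≤50 4≤w w≤hi-w =
  upper-bound₂ n w 4≤w w≤8 (ℕₚ.≤-trans monotone lo) n≤50 ,
  -- The smallest length 11 is exactly 8 + 3, so `w + 3 ≤ n` holds in every block.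
  lower-bound n w (ℕₚ.≤-trans (ℕₚ.n≤1+n 3) 4≤w) (ℕₚ.≤-trans (ℕₚ.+-monoˡ-≤ 3 w≤8) (ℕₚ.≤-trans at-least-11 lo))
  where
  w≤8 = ℕₚ.≤-trans w≤hi-w hi-w≤8
  monotone : lower₂ w ≤ lower₂ hi-w
  monotone = ℕₚ.≤ᵇ⇒≤ (lower₂ w) (lower₂ hi-w) (All.lookup (all⁺ (λ w → lower₂ w ≤ᵇ lower₂ hi-w) (range 4 hi-w)
    (All.lookup (all⁺ (λ h → all (λ w → lower₂ w ≤ᵇ lower₂ h) (range 4 h)) (range 4 8) tt) (∈-range 4≤hi-w hi-w≤8))) (∈-range 4≤w w≤hi-w))
  at-least-11 : 11 ≤ lower₂ hi-w
  at-least-11 = ℕₚ.≤ᵇ⇒≤ 11 (lower₂ hi-w) (All.lookup (all⁺ (λ h → 11 ≤ᵇ lower₂ h) (range 4 8) tt) (∈-range 4≤hi-w hi-w≤8))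

≤-by : ∀ m n → {_ : T (m ≤ᵇ n)} → m ≤ n
≤-by m n {ok} = ℕₚ.≤ᵇ⇒≤ m n ok

theorem3p5 : (∀ (n w : ℕ) → 11 ≤ n → n ≤ 45 → 4 ≤ w → 2 * w ≤ n →
    A≤ n w 3 ((n C 3) ∸ (n C 2) + n))
    ×
    (∀ (n w : ℕ) →
    ((11 ≤ n × n ≤ 12 × 4 ≤ w × w ≤ 4)
    ⊎ (13 ≤ n × n ≤ 15 × 4 ≤ w × w ≤ 5)
    ⊎ (16 ≤ n × n ≤ 19 × 4 ≤ w × w ≤ 6)
    ⊎ (20 ≤ n × n ≤ 24 × 4 ≤ w × w ≤ 7)
    ⊎ (25 ≤ n × n ≤ 50 × 4 ≤ w × w ≤ 8)) →
    A≡ n w 3 ((n ∸ w + 3) C 3))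
theorem3p5 = upper-bound₁ , equality
  where
  up-to : ∀ hi-w hi-n {_ : T (4 ≤ᵇ hi-w)} {_ : T (hi-w ≤ᵇ 8)} {_ : T (hi-n ≤ᵇ 50)} →
          ∀ n w → lower₂ hi-w ≤ n × n ≤ hi-n × 4 ≤ w × w ≤ hi-w → A≡ n w 3 (bound₂ n w)
  up-to hi-w hi-n {p} {q} {r} n w (lo , hi , 4≤w , w≤) =
    equality₂ n w hi-w (≤-by 4 hi-w {p}) (≤-by hi-w 8 {q}) lo (ℕₚ.≤-trans hi (≤-by hi-n 50 {r})) 4≤w w≤
  equality : ∀ n w → _ → A≡ n w 3 (bound₂ n w)
  -- The lower ends 11, 13, 16, 20 and 25 of the blocks are the values of `lower₂` at their largest
  -- weights, so `h` fits by computation.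
  equality n w (inj₁ h)                      = up-to 4 12 n w h
  equality n w (inj₂ (inj₁ h))               = up-to 5 15 n w h
  equality n w (inj₂ (inj₂ (inj₁ h)))        = up-to 6 19 n w h
  equality n w (inj₂ (inj₂ (inj₂ (inj₁ h)))) = up-to 7 24 n w h
  equality n w (inj₂ (inj₂ (inj₂ (inj₂ h)))) = up-to 8 50 n w h
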